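{- In the setting described in the context (where the restriction of $b$ to $B_1$ is a transposition and $d$ is even), $\rho(G(a,b))=\max\{1,\tfrac{6}{d}\}$. In particular, if $d\leq 6$, then $\rho(G(a,b))\in\{1,\tfrac32,3\}$.
   Context: Let $p\geq5$ be a prime and $G\leq\mathrm{Sym}(\Omega)$ transitive with $|\Omega|=3p$, whose only non-trivial $G$-invariant partition is $\mathcal{B}=\{B_1,\dots,B_p\}$, $B_i=\{x_i,y_i,z_i\}$. Let $\overline{G}\leq\mathrm{Sym}(\mathcal{B})$ be the induced group and $K=\ker(G\to\overline{G})$. Assume $K\neq1$, $K$ contains no derangement (every element of $K$ fixes a point), every minimal normal subgroup of $G$ contained in $K$ is an elementary abelian $3$-group, and $K$ contains no involution. Assume $\overline{G}$ is solvable and non-cyclic: $\overline{G}=\langle\alpha\rangle\rtimes\langle\beta\rangle\leq\mathrm{AGL}(1,p)$ with $\alpha=(B_1\,B_2\,\cdots\,B_p)$, $o(\beta)=d$ even, $d\mid p-1$, $\beta$ fixing $B_1$, $\beta\alpha\beta^{ -1}=\alpha^t$ with $\gcd(t,p)=1$. Let $a=(x_1\,\cdots\,x_p)(y_1\,\cdots\,y_p)(z_1\,\cdots\,z_p)\in G$ (with image $\alpha$) and $b\in G$ with image $\beta$, and assume the restriction of $b$ to $B_1$ is a transposition. Let $G(a,b)=\langle K,a,b\rangle$. For a transitive group $H\leq\mathrm{Sym}(\Omega)$, $\rho(H)=\max\{|\mathcal{F}|:\mathcal{F}\subseteq H\text{ intersecting}\}/|H_\omega|$, where $\mathcal{F}$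 is intersecting if any two of its elements agree on some point of $\Omega$. -}

module Defs where

open import Level using (Level; _⊔_) renaming (suc to lsuc; zero to lzero)
open import Data.Nat using (ℕ; zero; suc; _+_; _*_; _≤_; _<_; NonZero; >-nonZero⁻¹)
open import Data.Nat.DivMod using (_%_; m%n<n)
open import Data.Fin using (Fin; toℕ; fromℕ<; combine; remQuot)
open import Data.Vec using (Vec; lookup; tabulate; allFin)
open import Data.List using (List; length)
open import Data.List.Membership.Propositional using (_∈_)
open import Data.List.Relation.Unary.All using (All)
open import Data.List.Relation.Unary.Unique.Propositional using (Unique)
open import Data.Product using (Σ; ∃; ∃-syntax; _×_; _,_; proj₁)
open import Data.Sum using (_⊎_)
open import Data.Empty using (⊥)
open import Relation.Nullary using (¬_)
open import Relation.Binary.PropositionalEquality using (_≡_; _≢_)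
open import Function.Bundles using (_⇔_)

-- Maps of Fin n, represented as vectors (so that ≡ is the right equality)

Map : ℕ → Set
Map n = Vec (Fin n) n

infixl 9 _$_
_$_ : ∀ {n} → Map n → Fin n → Fin n
σ $ x = lookup σ x

infixl 7 _·_
_·_ : ∀ {n} → Map n → Map n → Map n
σ · τ = tabulate (λ i → σ $ (τ $ i))

idP : ∀ {n} → Map n
idP {n} = allFin n

pow : ∀ {n} → Map n → ℕ → Map n
pow σ zero    = idP
pow σ (suc k) = σ · pow σ k

IsPerm : ∀ {n} → Map n → Set
IsPerm σ = ∀ x y → σ $ x ≡ σ $ y → x ≡ y

PSet : ℕ → Set₁
PSet n = Map n → Set

_⊆_ : ∀ {n} → PSet n → PSet n → Set
A ⊆ B = ∀ σ → A σ → B σ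

record IsSubgroup {n} (H : PSet n) : Set where
  field
    perm : ∀ σ → H σ → IsPerm σ
    id∈  : H idP
    mul∈ : ∀ σ τ → H σ → H τ → H (σ · τ)
    inv∈ : ∀ σ → H σ → ∃[ τ ] (H τ × σ · τ ≡ idP × τ · σ ≡ idP)

-- subgroup generated by a set S of permutations (for permutations of a
-- finite set the submonoid generated is the subgroup generated)
data Gen {n} (S : PSet n) : Map n → Set where
  gen : ∀ σ → S σ → Gen S σ
  one : Gen S idP
  mul : ∀ σ τ → Gen S σ → Gen S τ → Gen S (σ · τ)

HasOrder : ∀ {n} → Map n → ℕ → Set
HasOrder σ d = (0 < d) × (pow σ d ≡ idP) × (∀ k → 0 < k → k < d → pow σ k ≢ idP)

Transitive : ∀ {n} → PSet n → Set
Transitive {n} G = ∀ (x y : Fin n) → ∃[ g ] (G g × g $ x ≡ y)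

record IsInvariantPartition {n} (G : PSet n) (R : Fin n → Fin n → Set) : Set where
  field
    refl'  : ∀ x → R x x
    sym'   : ∀ x y → R x y → R y x
    trans' : ∀ x y z → R x y → R y z → R x z
    inv    : ∀ g x y → G g → R x y → R (g $ x) (g $ y)

NonTrivialRel : ∀ {n} → (Fin n → Fin n → Set) → Set
NonTrivialRel {n} R = ¬ (∀ x y → R x y → x ≡ y) × ¬ (∀ (x y : Fin n) → R x y)

IsNormalSub : ∀ {n} → PSet n → PSet n → Set
IsNormalSub G N = IsSubgroup N × (N ⊆ G) ×
  (∀ g h σ → G g → G h → g · h ≡ idP → N σ → N (g · σ · h))

Trivial : ∀ {n} → PSet n → Set
Trivial N = ∀ σ → N σ → σ ≡ idP

IsMinimalNormal : ∀ {n} → PSet n → PSet n → Set₁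
IsMinimalNormal G N = IsNormalSub G N × ¬ Trivial N ×
  (∀ (M : PSet _) → IsNormalSub G M → M ⊆ N → Trivial M ⊎ N ⊆ M)

IsElemAbelian3 : ∀ {n} → PSet n → Set
IsElemAbelian3 N = (∀ σ τ → N σ → N τ → σ · τ ≡ τ · σ) × (∀ σ → N σ → pow σ 3 ≡ idP)

-- Ω = Fin (p * 3); the point (i , j) is  combine i j ;  j = 0,1,2 are x,y,z
-- block B_{i+1} = { combine i j | j : Fin 3 }

pt : ∀ {p} → Fin p → Fin 3 → Fin (p * 3)
pt i j = combine i j

blk : ∀ {p} → Fin (p * 3) → Fin p
blk {p} x = proj₁ (remQuot {p} 3 x)

SameBlock : ∀ {p} → Fin (p * 3) → Fin (p * 3) → Set
SameBlock {p} x y = blk {p} x ≡ blk {p} y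

-- the permutation of blocks induced by g (meaningful when g preserves B)
ind : ∀ {p} → Map (p * 3) → Map p
ind {p} g = tabulate (λ i → blk {p} (g $ pt i Data.Fin.zero))

Ker : ∀ {p} → PSet (p * 3) → PSet (p * 3)
Ker {p} G σ = G σ × (∀ x → blk {p} (σ $ x) ≡ blk {p} x)

Bar : ∀ {p} → PSet (p * 3) → PSet p
Bar {p} G σ = ∃[ g ] (G g × ind {p} g ≡ σ)

fz : ∀ {p} → .{{NonZero p}} → Fin p
fz {p} = fromℕ< (>-nonZero⁻¹ p)

sucMod : ∀ {p} → .{{NonZero p}} → Fin p → Fin p
sucMod {p} i = fromℕ< (m%n<n (suc (toℕ i)) p)

alpha : ∀ {p} → .{{NonZero p}} → Map p
alpha = tabulate sucMod

InAGL1 : ∀ {p} → .{{NonZero p}} → Map p → Set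
InAGL1 {p} σ = ∃[ c ] ∃[ e ] (∀ i → toℕ (σ $ i) ≡ (c * toℕ i + e) % p)

Cyclic : ∀ {n} → PSet n → Set
Cyclic H = ∃[ γ ] (H γ × ∀ σ → H σ → ∃[ k ] (σ ≡ pow γ k))

Intersecting : ∀ {n} → List (Map n) → Set
Intersecting F = ∀ g h → g ∈ F → h ∈ F → ∃[ x ] (g $ x ≡ h $ x)

IsMaxIntersectingSize : ∀ {n} → PSet n → ℕ → Set
IsMaxIntersectingSize H m =
  (∃[ F ] (Unique F × All H F × Intersecting F × length F ≡ m)) ×
  (∀ F → Unique F → All H F → Intersecting F → length F ≤ m)

IsStabSize : ∀ {n} → PSet n → Fin n → ℕ → Set
IsStabSize H ω s = ∃[ L ] (Unique L × (∀ σ → (σ ∈ L) ⇔ (H σ × σ $ ω ≡ ω)) × length L ≡ s)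

-- G equals ⟨K, a, b⟩, and every element acts on the blocks by n ↦ γ + tʲ n, with j taken
-- modulo d, and on the labels of each block by l ↦ c ± l, the sign being the parity of j: K
-- consists of translations since it has no involution, a is label-preserving, and b is a
-- reflection on every block. Two elements of the same class j that agree at a point differ by an
-- element of K, so the part of an intersecting family in one class has at most |K| members.
-- Elements of two classes of the same parity send exactly one block to the same block, and agree
-- on all of it once they agree at one of its points; so when two classes of a parity occur, each
-- contributes at most |K|/3. Summing over the classes of each parity gives the bound
-- 2 max(3, d/2) |K|/3, which K ∪ bK attains for d ≤ 6 and a point stabiliser, of order d |K|/3,
-- for d ≥ 6.

module Submission where

open import Defs
open import Data.Nat as ℕ
  using (ℕ; zero; suc; _+_; _*_; _^_; _∸_; _⊔_; _≤_; _<_; z≤n; s≤s; NonZero)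
import Data.Nat.Properties as ℕ
import Data.Nat.DivMod as DivMod
open DivMod using (_%_; _/_)
open import Data.Nat.Divisibility as ∣ using (_∣_)
open import Data.Nat.Primality using (Prime; euclidsLemma)
open import Data.Nat.Coprimality using (Coprime)
open import Data.Nat.Tactic.RingSolver using (solve-∀)
open import Data.Fin as Fin using (Fin; zero; suc; toℕ; fromℕ<)
open import Data.Fin.Patterns using (0F; 1F; 2F)
import Data.Fin.Properties as Fin
open import Data.Vec as Vec using (Vec; []; _∷_)
import Data.Vec.Properties as Vec
open import Data.List as List using (List; []; _∷_; _++_; length; map; filter)
import Data.List.Properties as List
open import Data.List.Membership.Propositional using (_∈_)
open import Data.List.Membership.Propositional.Properties
  using (∈-map⁺; ∈-map⁻; ∈-++⁺ˡ; ∈-++⁺ʳ; ∈-++⁻; ∈-filter⁺; ∈-filter⁻; ∈-allFin;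
         ∈-cartesianProductWith⁺)
open import Data.List.Relation.Unary.Any as Any using (here; there)
open import Data.List.Relation.Unary.All as All using (All; []; _∷_)
open import Data.List.Relation.Unary.AllPairs using ([]; _∷_)
open import Data.List.Relation.Unary.Unique.Propositional using (Unique)
import Data.List.Relation.Unary.Unique.Propositional.Properties as Unique
open import Data.Product using (∃-syntax; _×_; _,_; proj₁; proj₂)
open import Data.Sum using (_⊎_; inj₁; inj₂; [_,_]′)
open import Data.Empty using (⊥; ⊥-elim)
open import Relation.Nullary using (¬_; Dec; yes; no; ¬?)
open import Relation.Nullary.Decidable
  using (from-yes; ¬¬-excluded-middle; toSum; decidable-stable; _×-dec_; _⊎-dec_; _→-dec_)
open import Relation.Unary using (Decidable)
open import Relation.Binary.Definitions using (DecidableEquality; tri<; tri≈; tri>)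
open import Relation.Binary.PropositionalEquality
  using (_≡_; _≢_; refl; sym; trans; cong; cong₂; subst; subst₂; module ≡-Reasoning)
open import Function using (_∘_)
open import Function.Bundles using (_⇔_; mk⇔; Equivalence)
open Equivalence using (to; from)

private
  variable
    n : ℕ

-- Composition of maps of a finite set.

ext : {σ τ : Map n} → (∀ i → σ $ i ≡ τ $ i) → σ ≡ τ
ext {σ = σ} {τ} e = trans (sym (Vec.tabulate∘lookup σ))
  (trans (Vec.tabulate-cong e) (Vec.tabulate∘lookup τ))

·-$ : (σ τ : Map n) (i : Fin n) → (σ · τ) $ i ≡ σ $ (τ $ i)
·-$ σ τ i = Vec.lookup∘tabulate _ i

id-$ : (i : Fin n) → idP $ i ≡ i
id-$ = Vec.lookup-allFin

·-assoc : (ρ σ τ : Map n) → (ρ · σ) · τ ≡ ρ · (σ · τ)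
·-assoc ρ σ τ = ext λ i → trans (·-$ (ρ · σ) τ i) (trans (·-$ ρ σ (τ $ i))
  (sym (trans (·-$ ρ (σ · τ) i) (cong (ρ $_) (·-$ σ τ i)))))

·-idˡ : (σ : Map n) → idP · σ ≡ σ
·-idˡ σ = ext λ i → trans (·-$ idP σ i) (id-$ _)

·-cancelˡ : {σ : Map n} → IsPerm σ → {τ τ′ : Map n} → σ · τ ≡ σ · τ′ → τ ≡ τ′
·-cancelˡ {σ = σ} inj {τ} {τ′} e = ext λ i → inj _ _
  (trans (sym (·-$ σ τ i)) (trans (cong (_$ i) e) (·-$ σ τ′ i)))

_≟_ : DecidableEquality (Map n)
_≟_ = Vec.≡-dec Fin._≟_

-- Counting with duplicate-free lists

-- Deleting the head of `xs` from `ys` strictly shortens `ys`, and the tail of `xs` survives in it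
-- because it avoids the head.
unique-⊆-length : ∀ {A : Set} → DecidableEquality A → {xs ys : List A} → Unique xs →
  (∀ {x} → x ∈ xs → x ∈ ys) → length xs ≤ length ys
unique-⊆-length _≟ᴬ_ [] sub = z≤n
unique-⊆-length _≟ᴬ_ {x ∷ xs} {ys} (x∉ ∷ u) sub = ℕ.≤-<-trans
  (unique-⊆-length _≟ᴬ_ u λ z∈ → ∈-filter⁺ ≢x? (sub (there z∈)) (All.lookup x∉ z∈ ∘ sym))
  (List.filter-notAll ≢x? ys (Any.map (λ x≡y y≢x → y≢x (sym x≡y)) (sub (here refl))))
  where
  ≢x? : Decidable (_≢ x)
  ≢x? y = ¬? (y ≟ᴬ x)

length-partition : ∀ {A : Set} {P : A → Set} (P? : Decidable P) (xs : List A) →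
  length xs ≡ length (filter P? xs) + length (filter (¬? ∘ P?) xs)
length-partition P? [] = refl
length-partition P? (x ∷ xs) with P? x
... | yes _ = cong suc (length-partition P? xs)
... | no  _ = trans (cong suc (length-partition P? xs)) (sym (ℕ.+-suc _ _))

-- The `P i` may overlap: an element is counted with the first one it satisfies. Bounding every
-- duplicate-free list inside `xs`, not only the fibres, lets the hypothesis pass to the filtered
-- remainder.
fibre-bound : ∀ {A : Set} {m C} (P : Fin m → A → Set) → (∀ i → Decidable (P i)) →
  (xs : List A) → Unique xs → (∀ {x} → x ∈ xs → ∃[ i ] P i x) →
  (∀ i ys → Unique ys → (∀ {y} → y ∈ ys → y ∈ xs × P i y) → length ys ≤ C) →
  length xs ≤ m * C
fibre-bound {m = zero} P P? [] u cover small = z≤n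
fibre-bound {m = zero} P P? (x ∷ xs) u cover small with () ← proj₁ (cover (here refl))
fibre-bound {m = suc m} {C} P P? xs u cover small = begin
  length xs                    ≡⟨ length-partition (P? zero) xs ⟩
  length in₀ + length out₀     ≤⟨ ℕ.+-mono-≤
    (small zero in₀ (Unique.filter⁺ (P? zero) u) (∈-filter⁻ (P? zero)))
    (fibre-bound (P ∘ suc) (P? ∘ suc) out₀ (Unique.filter⁺ _ u) cover′ small′) ⟩
  C + m * C                    ∎
  where
  open ℕ.≤-Reasoning
  in₀ = filter (P? zero) xs
  out₀ = filter (¬? ∘ P? zero) xs
  cover′ : ∀ {x} → x ∈ out₀ → ∃[ i ] P (suc i) x
  cover′ x∈ with ∈-filter⁻ (¬? ∘ P? zero) {xs = xs} x∈
  ... | x∈xs , ¬p with cover x∈xs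
  ...   | zero  , p = ⊥-elim (¬p p)
  ...   | suc i , p = i , p
  small′ : ∀ i ys → Unique ys → (∀ {y} → y ∈ ys → y ∈ out₀ × P (suc i) y) → length ys ≤ C
  small′ i ys u′ sub = small (suc i) ys u′ λ y∈ →
    proj₁ (∈-filter⁻ (¬? ∘ P? zero) {xs = xs} (proj₁ (sub y∈))) , proj₂ (sub y∈)

HasSize : PSet n → ℕ → Set
HasSize H s = ∃[ L ] (Unique L × (∀ σ → (σ ∈ L) ⇔ H σ) × length L ≡ s)

vectors : ∀ n m → List (Vec (Fin n) m)
vectors n zero    = [] ∷ []
vectors n (suc m) = List.cartesianProductWith _∷_ (List.allFin n) (vectors n m)

∈-vectors : ∀ {n m} (v : Vec (Fin n) m) → v ∈ vectors n m
∈-vectors []      = here refl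
∈-vectors (x ∷ v) = ∈-cartesianProductWith⁺ _∷_ (∈-allFin x) (∈-vectors v)

vectors-unique : ∀ n m → Unique (vectors n m)
vectors-unique n zero    = [] ∷ []
vectors-unique n (suc m) = Unique.cartesianProductWith⁺ _∷_ Vec.∷-injective
  (Unique.allFin⁺ n) (vectors-unique n m)

hasSize : {H : PSet n} → Decidable H → ∃[ s ] HasSize H s
hasSize {n} {H} H? = length L , L , Unique.filter⁺ H? (vectors-unique n n) ,
  (λ σ → mk⇔ (proj₂ ∘ ∈-filter⁻ H? {xs = vectors n n}) (∈-filter⁺ H? (∈-vectors σ))) , refl
  where
  L = filter H? (vectors n n)

size-bound : ∀ {H : PSet n} {s} → HasSize H s → ∀ {xs} → Unique xs →
  (∀ {σ} → σ ∈ xs → H σ) → length xs ≤ s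
size-bound (L , _ , ∈⇔ , refl) u sub = unique-⊆-length _≟_ u λ {σ} σ∈ → from (∈⇔ σ) (sub σ∈)

size-unique : ∀ {H : PSet n} {r s} → HasSize H r → HasSize H s → r ≡ s
size-unique A@(L , u , ∈⇔ , refl) B@(L′ , u′ , ∈⇔′ , refl) = ℕ.≤-antisym
  (size-bound B u (λ {σ} → to (∈⇔ σ))) (size-bound A u′ (λ {σ} → to (∈⇔′ σ)))

-- At each use `h` is the inverse of a member `g` of the list, so the list lies in the coset `gN`;
-- left multiplication by `h` is injective and carries it into `N`.
size-coset : ∀ {N : PSet n} {s} → HasSize N s → (g h : Map n) → g · h ≡ idP → ∀ {xs} → Unique xs →
  (∀ {σ} → σ ∈ xs → N (h · σ)) → length xs ≤ s
size-coset {N = N} sz g h gh {xs} u sub = subst (_≤ _) (List.length-map (h ·_) xs)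
  (size-bound sz (Unique.map⁺ inj u) λ τ∈ → let σ , σ∈ , e = ∈-map⁻ (h ·_) τ∈ in subst N (sym e) (sub σ∈))
  where
  undo : ∀ σ → g · (h · σ) ≡ σ
  undo σ = trans (sym (·-assoc g h σ)) (trans (cong (_· σ) gh) (·-idˡ σ))
  inj : ∀ {σ τ} → h · σ ≡ h · τ → σ ≡ τ
  inj {σ} {τ} e = trans (sym (undo σ)) (trans (cong (g ·_) e) (undo τ))

-- Lagrange's count with an explicit transversal `u`. Disjointness of the cosets is assumed, since
-- at each use an invariant of the product, the image of a point or the class, reveals its
-- representative.
size-cosets : ∀ {m s} {H N : PSet n} → HasSize N s → (u : Fin m → Map n) →
  (∀ i → IsPerm (u i)) →
  (∀ i j σ τ → N σ → N τ → u i · σ ≡ u j · τ → i ≡ j) →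
  (∀ σ → H σ ⇔ (∃[ i ] ∃[ τ ] (N τ × σ ≡ u i · τ))) →
  HasSize H (m * s)
size-cosets {m = zero} sz u per dis H⇔ = [] , [] ,
  (λ σ → mk⇔ (λ ()) (λ h → ⊥-elim (Fin.¬Fin0 (proj₁ (to (H⇔ σ) h))))) , refl
size-cosets {n} {suc m} {s} {H} {N} sz@(L , uL , L⇔ , ∣L∣) u per dis H⇔ =
  first ++ rest , Unique.++⁺ (Unique.map⁺ (·-cancelˡ {σ = u zero} (per zero)) uL) uR disjoint ,
  (λ σ → mk⇔ (from (H⇔ σ) ∘ [ in-first , in-rest ]′ ∘ ∈-++⁻ first) (into σ ∘ to (H⇔ σ))) ,
  trans (List.length-++ first) (cong₂ _+_ (trans (List.length-map _ L) ∣L∣) ∣R∣)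
  where
  first = map (u zero ·_) L
  Later : PSet n
  Later σ = ∃[ i ] ∃[ τ ] (N τ × σ ≡ u (suc i) · τ)
  later : HasSize Later (m * s)
  later = size-cosets sz (u ∘ suc) (per ∘ suc)
    (λ i j σ τ Nσ Nτ e → Fin.suc-injective (dis (suc i) (suc j) σ τ Nσ Nτ e))
    (λ σ → mk⇔ (λ x → x) (λ x → x))
  rest = proj₁ later
  uR = proj₁ (proj₂ later)
  R⇔ = proj₁ (proj₂ (proj₂ later))
  ∣R∣ = proj₂ (proj₂ (proj₂ later))
  in-first : ∀ {σ} → σ ∈ first → ∃[ i ] ∃[ τ ] (N τ × σ ≡ u i · τ)
  in-first σ∈ = let τ , τ∈ , e = ∈-map⁻ (u zero ·_) σ∈ in zero , τ , to (L⇔ τ) τ∈ , e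
  in-rest : ∀ {σ} → σ ∈ rest → ∃[ i ] ∃[ τ ] (N τ × σ ≡ u i · τ)
  in-rest {σ} σ∈ = let i , x = to (R⇔ σ) σ∈ in suc i , x
  disjoint : ∀ {σ} → σ ∈ first × σ ∈ rest → ⊥
  disjoint {σ} (∈f , ∈r) with ∈-map⁻ (u zero ·_) ∈f | to (R⇔ σ) ∈r
  ... | τ , τ∈ , e | i , τ′ , Nτ′ , e′
    with () ← dis zero (suc i) τ τ′ (to (L⇔ τ) τ∈) Nτ′ (trans (sym e) e′)
  into : ∀ σ → (∃[ i ] ∃[ τ ] (N τ × σ ≡ u i · τ)) → σ ∈ first ++ rest
  into σ (zero  , τ , Nτ , refl) = ∈-++⁺ˡ (∈-map⁺ (u zero ·_) (from (L⇔ τ) Nτ))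
  into σ (suc i , τ , Nτ , e) = ∈-++⁺ʳ first (from (R⇔ σ) (i , τ , Nτ , e))

-- Sym(3) as the affine group of ℤ/3

_⊕_ : Fin 3 → Fin 3 → Fin 3
0F ⊕ l  = l
1F ⊕ 0F = 1F
1F ⊕ 1F = 2F
1F ⊕ 2F = 0F
2F ⊕ 0F = 2F
2F ⊕ 1F = 0F
2F ⊕ 2F = 1F

neg : Fin 3 → Fin 3
neg 0F = 0F
neg 1F = 2F
neg 2F = 1F

-- The first argument is the sign of the permutation: the three translations are even, and the maps
-- `c - l` are the three transpositions.
act : Fin 2 → Fin 3 → Fin 3 → Fin 3
act 0F c l = c ⊕ l
act 1F c l = c ⊕ neg l

_⊻_ : Fin 2 → Fin 2 → Fin 2
0F ⊻ δ  = δ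
1F ⊻ 0F = 1F
1F ⊻ 1F = 0F

⊻-assoc : ∀ ε δ ζ → (ε ⊻ δ) ⊻ ζ ≡ ε ⊻ (δ ⊻ ζ)
⊻-assoc = from-yes (Fin.all? λ ε → Fin.all? λ δ → Fin.all? λ ζ → ((ε ⊻ δ) ⊻ ζ) Fin.≟ (ε ⊻ (δ ⊻ ζ)))

⊻-idʳ : ∀ ε → ε ⊻ 0F ≡ ε
⊻-idʳ 0F = refl
⊻-idʳ 1F = refl

parity : ℕ → Fin 2
parity zero    = 0F
parity (suc j) = 1F ⊻ parity j

parity-+ : ∀ i j → parity (i + j) ≡ parity i ⊻ parity j
parity-+ zero    j = refl
parity-+ (suc i) j = trans (cong (1F ⊻_) (parity-+ i j)) (sym (⊻-assoc 1F (parity i) (parity j)))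

parity-*2 : ∀ q → parity (q * 2) ≡ 0F
parity-*2 zero    = refl
parity-*2 (suc q) = cong (λ ε → 1F ⊻ (1F ⊻ ε)) (parity-*2 q)

-- abstract, because unfolding these decision procedures makes later unification blow up.
abstract
  act-classify : ∀ x y z → x ≢ y → x ≢ z → y ≢ z →
    ∃[ ε ] ∃[ c ] (x ≡ act ε c 0F × y ≡ act ε c 1F × z ≡ act ε c 2F)
  act-classify = from-yes (Fin.all? λ x → Fin.all? λ y → Fin.all? λ z →
    ¬? (x Fin.≟ y) →-dec (¬? (x Fin.≟ z) →-dec (¬? (y Fin.≟ z) →-dec
      Fin.any? λ ε → Fin.any? λ c →
        (x Fin.≟ act ε c 0F) ×-dec ((y Fin.≟ act ε c 1F) ×-dec (z Fin.≟ act ε c 2F)))))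

  act-∘ : ∀ ε δ c e l → act ε c (act δ e l) ≡ act (ε ⊻ δ) (act ε c e) l
  act-∘ = from-yes (Fin.all? λ ε → Fin.all? λ δ → Fin.all? λ c → Fin.all? λ e → Fin.all? λ l →
    act ε c (act δ e l) Fin.≟ act (ε ⊻ δ) (act ε c e) l)

  -- For a fixed sign the three permutations form a regular set, so a single value determines the
  -- constant.
  act-constant : ∀ ε c e l → act ε c l ≡ act ε e l → c ≡ e
  act-constant = from-yes (Fin.all? λ ε → Fin.all? λ c → Fin.all? λ e → Fin.all? λ l →
    (act ε c l Fin.≟ act ε e l) →-dec (c Fin.≟ e))

  act-parity : ∀ ε δ c e → (∀ l → act ε c l ≡ act δ e l) → ε ≡ δ
  act-parity = from-yes (Fin.all? λ ε → Fin.all? λ δ → Fin.all? λ c → Fin.all? λ e →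
    (Fin.all? λ l → act ε c l Fin.≟ act δ e l) →-dec (ε Fin.≟ δ))

  act-sixth : ∀ ε c l → let f = act ε c in f (f (f (f (f (f l))))) ≡ l
  act-sixth = from-yes (Fin.all? λ ε → Fin.all? λ c → Fin.all? λ l →
    let f = act ε c in f (f (f (f (f (f l))))) Fin.≟ l)

  -- A reflection is its own cube, hence its cube is not the identity.
  act-cubed : ∀ ε c → (∀ l → let f = act ε c in f (f (f l)) ≡ l) → ε ≡ 0F
  act-cubed = from-yes (Fin.all? λ ε → Fin.all? λ c →
    (Fin.all? λ l → let f = act ε c in f (f (f l)) Fin.≟ l) →-dec (ε Fin.≟ 0F))

  translation-orbit : ∀ c → c ≢ 0F → ∀ l → l ≡ 0F ⊎ l ≡ c ⊎ l ≡ c ⊕ c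
  translation-orbit = from-yes (Fin.all? λ c → ¬? (c Fin.≟ 0F) →-dec
    Fin.all? λ l → (l Fin.≟ 0F) ⊎-dec ((l Fin.≟ c) ⊎-dec (l Fin.≟ (c ⊕ c))))

  -- The equation `c + l = e - l` asks for `2 l = e - c`, and 2 is invertible modulo 3.
  even-odd-meet : ∀ c e → ∃[ l ] act 0F c l ≡ act 1F e l
  even-odd-meet = from-yes (Fin.all? λ c → Fin.all? λ e → Fin.any? λ l → act 0F c l Fin.≟ act 1F e l)

  -- A translation has order 1 or 3, so it cannot exchange two labels.
  swap-odd : ∀ ε c j k → j ≢ k → act ε c j ≡ k → act ε c k ≡ j → ε ≡ 1F
  swap-odd = from-yes (Fin.all? λ ε → Fin.all? λ c → Fin.all? λ j → Fin.all? λ k →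
    ¬? (j Fin.≟ k) →-dec ((act ε c j Fin.≟ k) →-dec ((act ε c k Fin.≟ j) →-dec (ε Fin.≟ 1F))))

⊕-idʳ : ∀ c → c ⊕ 0F ≡ c
⊕-idʳ 0F = refl
⊕-idʳ 1F = refl
⊕-idʳ 2F = refl

-- Residues modulo p

module Residues (p : ℕ) .{{nz : NonZero p}} where

  infix 4 _~_
  _~_ : ℕ → ℕ → Set
  m ~ n = m % p ≡ n % p

  -- Multiples of `p` are added on both sides to avoid subtraction in ℕ; each side receives the
  -- quotient of the other.
  ~-witness : ∀ {m n} → m ~ n → ∃[ x ] ∃[ y ] m + x * p ≡ n + y * p
  ~-witness {m} {n} e = n / p , m / p , (begin
    m + n / p * p                     ≡⟨ cong (_+ n / p * p) (DivMod.m≡m%n+[m/n]*n m p) ⟩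
    m % p + m / p * p + n / p * p     ≡⟨ cong (λ r → r + m / p * p + n / p * p) e ⟩
    n % p + m / p * p + n / p * p     ≡⟨ swap (n % p) _ _ ⟩
    n % p + n / p * p + m / p * p     ≡⟨ cong (_+ m / p * p) (DivMod.m≡m%n+[m/n]*n n p) ⟨
    n + m / p * p                     ∎)
    where
    open ≡-Reasoning
    swap : ∀ x y z → x + y + z ≡ x + z + y
    swap = solve-∀

  witness-~ : ∀ {m n} x y → m + x * p ≡ n + y * p → m ~ n
  witness-~ {m} {n} x y e = trans (sym (DivMod.[m+kn]%n≡m%n m x p))
    (trans (DivMod.%-congˡ e) (DivMod.[m+kn]%n≡m%n n y p))

  ~-+ : ∀ {m m′ n n′} → m ~ m′ → n ~ n′ → m + n ~ m′ + n′
  ~-+ {m} {m′} {n} {n′} e f = trans (DivMod.%-distribˡ-+ m n p)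
    (trans (DivMod.%-congˡ (cong₂ _+_ e f)) (sym (DivMod.%-distribˡ-+ m′ n′ p)))

  ~-* : ∀ {m m′ n n′} → m ~ m′ → n ~ n′ → m * n ~ m′ * n′
  ~-* {m} {m′} {n} {n′} e f = trans (DivMod.%-distribˡ-* m n p)
    (trans (DivMod.%-congˡ (cong₂ _*_ e f)) (sym (DivMod.%-distribˡ-* m′ n′ p)))

  ~-cancelˡ : ∀ c {m n} → c + m ~ c + n → m ~ n
  ~-cancelˡ c {m} {n} e with ~-witness {c + m} {c + n} e
  ... | x , y , f = witness-~ x y (ℕ.+-cancelˡ-≡ c _ _
    (trans (sym (ℕ.+-assoc c m _)) (trans f (ℕ.+-assoc c n _))))

  ≡⇒~ : ∀ {m n} → m ≡ n → m ~ n
  ≡⇒~ refl = refl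

  ∣⇒~0 : ∀ {m} → p ∣ m → m ~ 0
  ∣⇒~0 (∣.divides-refl q) = trans (DivMod.m*n%n≡0 q p) (sym (DivMod.m*n%n≡0 0 p))

  ~0⇒∣ : ∀ {m} → m ~ 0 → p ∣ m
  ~0⇒∣ {m} e = ∣.m%n≡0⇒n∣m m p (trans e (DivMod.m*n%n≡0 0 p))

  abstract
    -- Blocks are named by arbitrary natural numbers, so that affine maps on them are formulas in ℕ.
    -- Being abstract, `res` is handled only through congruences.
    res : ℕ → Fin p
    res n = fromℕ< (DivMod.m%n<n n p)

    res-cong : ∀ {m n} → m ~ n → res m ≡ res n
    res-cong {m} {n} e = Fin.fromℕ<-cong _ _ e (DivMod.m%n<n m p) (DivMod.m%n<n n p)

    res-injective : ∀ {m n} → res m ≡ res n → m ~ n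
    res-injective {m} {n} e = trans (sym (Fin.toℕ-fromℕ< (DivMod.m%n<n m p)))
      (trans (cong toℕ e) (Fin.toℕ-fromℕ< (DivMod.m%n<n n p)))

    res-toℕ : ∀ i → res (toℕ i) ≡ i
    res-toℕ i = Fin.toℕ-injective (trans (Fin.toℕ-fromℕ< _) (DivMod.m<n⇒m%n≡m (Fin.toℕ<n i)))

    sucMod-res : ∀ n → sucMod (res n) ≡ res (suc n)
    sucMod-res n = res-cong {suc (toℕ (res n))} (~-+ {1} {1} {toℕ (res n)} {n} refl
      (res-injective (res-toℕ (res n))))

    fz-res : fz ≡ res 0
    fz-res = Fin.toℕ-injective (trans (Fin.toℕ-fromℕ< _)
      (sym (trans (Fin.toℕ-fromℕ< _) (DivMod.m*n%n≡0 0 p))))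

  module _ (pr : Prime p) where

    private
      -- For `u = suc v` the hypothesis cancels to `v * e ~ 0`, and primality gives `u ~ 1` or
      -- `e ~ 0`. For `u = 0` it already reads `n + e ~ n`.
      ordered : ∀ u n e → ¬ (u ~ 1) → (n + e) + u * n ~ n + u * (n + e) → n ~ n + e
      ordered zero    n e u≁1 h = sym (~-cancelˡ 0 (subst₂ _~_ (ℕ.+-identityʳ (n + e)) (ℕ.+-identityʳ n) h))
      ordered (suc v) n e u≁1 h = [ (λ p∣v → ⊥-elim (u≁1 (~-+ {1} {1} {v} {0} refl (∣⇒~0 p∣v)))) ,
          (λ p∣e → subst (_~ n + e) (ℕ.+-identityʳ n) (~-+ {n} {n} {0} {e} refl (sym (∣⇒~0 p∣e)))) ]′
          (euclidsLemma v e pr (~0⇒∣ (sym (~-cancelˡ c (subst₂ _~_ (left n e v) (right n e v) h)))))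
        where
        c = n + (n + e) + v * n
        left : ∀ n e v → (n + e) + suc v * n ≡ (n + (n + e) + v * n) + 0
        left = solve-∀
        right : ∀ n e v → n + suc v * (n + e) ≡ (n + (n + e) + v * n) + v * e
        right = solve-∀

    -- The hypothesis is (u - 1) (n - n′) ≡ 0, with both sides moved so that no subtraction occurs.
    fixed-unique : ∀ u n n′ → ¬ (u ~ 1) → n′ + u * n ~ n + u * n′ → n ~ n′
    fixed-unique u n n′ u≁1 h with ℕ.≤-total n n′
    ... | inj₁ n≤n′ = subst (n ~_) (ℕ.m+[n∸m]≡n n≤n′) (ordered u n (n′ ℕ.∸ n) u≁1
      (subst (λ m → m + u * n ~ n + u * m) (sym (ℕ.m+[n∸m]≡n n≤n′)) h))
    ... | inj₂ n′≤n = sym (subst (n′ ~_) (ℕ.m+[n∸m]≡n n′≤n) (ordered u n′ (n ℕ.∸ n′) u≁1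
      (subst (λ m → m + u * n′ ~ n′ + u * m) (sym (ℕ.m+[n∸m]≡n n′≤n)) (sym h))))

    module _ {t d : ℕ} (order : t ^ d ~ 1) (minimal : ∀ k → 0 < k → k < d → ¬ (t ^ k ~ 1)) where

      private
        -- Eliminating the constants from the two equations and dividing by `t ^ i` leaves the
        -- hypothesis of `fixed-unique` for `u = t ^ (j - i)`, which is not 1 by minimality of `d`.
        meet-ordered : ∀ {i j} → i < j → j < d → ∀ γ γ′ {n n′} →
          γ + t ^ i * n ~ γ′ + t ^ j * n → γ + t ^ i * n′ ~ γ′ + t ^ j * n′ → n ~ n′
        meet-ordered {i} {j} i<j j<d γ γ′ {n} {n′} e e′ = fixed-unique (t ^ δ) n n′
          (minimal δ (ℕ.m<n⇒0<n∸m i<j) (ℕ.≤-<-trans (ℕ.m∸n≤m j i) j<d)) cancelled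
          where
          δ = j ℕ.∸ i
          -- The inverse of `t ^ i` modulo `p`, because `t ^ d ~ 1`.
          w = t ^ (d ℕ.∸ i)
          A = t ^ i
          B = t ^ j
          B≡ : B ≡ A * t ^ δ
          B≡ = trans (cong (t ^_) (sym (ℕ.m+[n∸m]≡n (ℕ.<⇒≤ i<j)))) (ℕ.^-distribˡ-+-* t i δ)
          wA : w * A ~ 1
          wA = trans (≡⇒~ (trans (sym (ℕ.^-distribˡ-+-* t (d ℕ.∸ i) i))
            (cong (t ^_) (ℕ.m∸n+n≡m (ℕ.<⇒≤ (ℕ.<-trans i<j j<d)))))) order
          summed : A * n′ + B * n ~ A * n + B * n′
          -- The second equation is added in reverse, so that `γ + γ′` stands on both sides and
          -- cancels.
          summed = sym (~-cancelˡ (γ + γ′) (subst₂ _~_ (l γ γ′ A B n n′) (r γ γ′ A B n n′)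
            (~-+ {γ + A * n} {γ′ + B * n} {γ′ + B * n′} {γ + A * n′} e (sym e′))))
            where
            l : ∀ γ γ′ A B n n′ → (γ + A * n) + (γ′ + B * n′) ≡ (γ + γ′) + (A * n + B * n′)
            l = solve-∀
            r : ∀ γ γ′ A B n n′ → (γ′ + B * n) + (γ + A * n′) ≡ (γ + γ′) + (A * n′ + B * n)
            r = solve-∀
          unit : ∀ x y → w * (A * x + B * y) ~ x + t ^ δ * y
          unit x y = trans (≡⇒~ (trans (cong (λ b → w * (A * x + b * y)) B≡) (l w A (t ^ δ) x y)))
            (trans (~-* {w * A} {1} {x + t ^ δ * y} wA refl) (≡⇒~ (ℕ.*-identityˡ _)))
            where
            l : ∀ w A u x y → w * (A * x + A * u * y) ≡ w * A * (x + u * y)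
            l = solve-∀
          cancelled : n′ + t ^ δ * n ~ n + t ^ δ * n′
          cancelled = trans (sym (unit n′ n)) (trans (~-* {w} {w} refl summed) (unit n n′))

      meet-unique : ∀ {i j} → i ≢ j → i < d → j < d → ∀ γ γ′ {n n′} →
        γ + t ^ i * n ~ γ′ + t ^ j * n → γ + t ^ i * n′ ~ γ′ + t ^ j * n′ → n ~ n′
      meet-unique {i} {j} i≢j i<d j<d γ γ′ e e′ with ℕ.<-cmp i j
      ... | tri< i<j _ _ = meet-ordered i<j j<d γ γ′ e e′
      ... | tri≈ _ i≡j _ = ⊥-elim (i≢j i≡j)
      ... | tri> _ _ j<i = meet-ordered j<i i<d γ′ γ (sym e) (sym e′)

-- The group, its blocks and its kernel.

module Setting
  (p e t : ℕ) .{{nz : NonZero p}} (pr : Prime p) (5≤p : 5 ≤ p)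
  (G : PSet (p * 3)) (subgroup : IsSubgroup G) (transitive : Transitive G)
  (partition : IsInvariantPartition G (SameBlock {p}))
  (only : ∀ (R : Fin (p * 3) → Fin (p * 3) → Set) → IsInvariantPartition G R → NonTrivialRel R →
    ∀ x y → R x y ⇔ SameBlock {p} x y)
  (K-nontrivial : ¬ Trivial (Ker {p} G))
  (K-fixes : ∀ σ → Ker {p} G σ → ∃[ x ] (σ $ x ≡ x))
  (K-no-involution : ∀ σ → Ker {p} G σ → σ · σ ≡ idP → σ ≡ idP)
  (a b : Map (p * 3)) (Ga : G a) (Gb : G b)
  (a-acts : ∀ i j → a $ pt i j ≡ pt (sucMod i) j)
  (b-order : HasOrder (ind {p} b) (e * 2))
  (b-fixes : ind {p} b $ fz ≡ fz)
  (b-rel : ind {p} b · alpha ≡ pow alpha t · ind {p} b)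
  (bar-gen : ∀ σ → Bar {p} G σ → Gen (λ τ → τ ≡ alpha ⊎ τ ≡ ind {p} b) σ)
  (b-swaps : ∃[ j ] ∃[ k ] (j ≢ k × b $ pt fz j ≡ pt fz k × b $ pt fz k ≡ pt fz j))
  where

  open IsSubgroup subgroup
  open IsInvariantPartition partition
  open Residues p

  d : ℕ
  d = e * 2

  K : PSet (p * 3)
  K = Ker {p} G

  H : PSet (p * 3)
  H = Gen (λ σ → K σ ⊎ σ ≡ a ⊎ σ ≡ b)

  at : Fin p → Fin 3 → Fin (p * 3)
  at = pt {p}

  0≁1 : ¬ (0 ~ 1)
  0≁1 h with s≤s () ← ℕ.≤-trans 5≤p (∣.∣⇒≤ (~0⇒∣ (sym h)))

  blk-at : ∀ i l → blk (at i l) ≡ i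
  blk-at i l = cong proj₁ (Fin.remQuot-combine i l)

  everywhere : (P : Fin (p * 3) → Set) → (∀ n l → P (at (res n) l)) → ∀ x → P x
  everywhere P h x = let i , l , q = Fin.combine-surjective {p} {3} x in
    subst P q (subst (λ i → P (at i l)) (res-toℕ i) (h (toℕ i) l))

  at-injectiveʳ : ∀ {i j : Fin p} {k l} → at i k ≡ at j l → k ≡ l
  at-injectiveʳ q = Fin.combine-injectiveʳ {p} _ _ _ _ q

  at-injectiveˡ : ∀ {i j : Fin p} {k l} → at i k ≡ at j l → i ≡ j
  at-injectiveˡ q = Fin.combine-injectiveˡ {p} _ _ _ _ q

  -- Refining the block relation by a proposition P gives an invariant partition, and
  -- the uniqueness of the block relation then decides P.
  stable : (P : Set) → ¬ ¬ P → P
  stable P ¬¬P = [ (λ q → ⊥-elim (0≢1 (at-injectiveʳ q))) , proj₂ ]′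
      (from (only R invariant nontrivial (at fz 0F) (at fz 1F)) same)
    where
    R : Fin (p * 3) → Fin (p * 3) → Set
    R x y = x ≡ y ⊎ (SameBlock {p} x y × P)
    0≢1 : _≢_ {A = Fin 3} 0F 1F
    0≢1 ()
    same : SameBlock {p} (at fz 0F) (at fz 1F)
    same = trans (blk-at fz 0F) (sym (blk-at fz 1F))
    invariant : IsInvariantPartition G R
    invariant = record
      { refl'  = λ x → inj₁ refl
      ; sym'   = λ { x y (inj₁ q) → inj₁ (sym q) ; x y (inj₂ (s , q)) → inj₂ (sym s , q) }
      ; trans' = λ { x y z (inj₁ refl) r → r
                   ; x y z (inj₂ r) (inj₁ refl) → inj₂ r
                   ; x y z (inj₂ (r , q)) (inj₂ (s , _)) → inj₂ (trans r s , q) }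
      ; inv    = λ { g x y Gg (inj₁ refl) → inj₁ refl
                   ; g x y Gg (inj₂ (s , q)) → inj₂ (inv g x y Gg s , q) } }
    nontrivial : NonTrivialRel R
    nontrivial =
      -- The goal is a negation, so `¬¬P` may be used here: under `P` two points of one block are
      -- related.
      (λ f → ¬¬P λ q → 0≢1 (at-injectiveʳ (f (at fz 0F) (at fz 1F) (inj₂ (same , q))))) ,
      (λ f → [ (λ q → 0≁1 (res-injective (at-injectiveˡ q))) ,
               (λ { (s , _) → 0≁1 (res-injective (trans (sym (blk-at _ 0F)) (trans s (blk-at _ 0F)))) }) ]′
             (f (at (res 0) 0F) (at (res 1) 0F)))

  -- This makes predicates such as `K` decidable, hence countable, and allows case distinctions on
  -- the classes that occur in a family.
  em : (P : Set) → Dec P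
  em P = stable (Dec P) ¬¬-excluded-middle

  -- Induced action on the blocks.

  ind-at : ∀ {g} → G g → ∀ i l → blk (g $ at i l) ≡ ind {p} g $ i
  ind-at {g} Gg i l = trans (inv g _ _ Gg (trans (blk-at i l) (sym (blk-at i 0F))))
    (sym (Vec.lookup∘tabulate _ i))

  ind-blk : ∀ {g} → G g → ∀ x → blk (g $ x) ≡ ind {p} g $ blk x
  ind-blk {g} Gg x = trans (cong (λ y → blk (g $ y)) (sym (Fin.combine-remQuot {p} 3 x))) (ind-at Gg _ _)

  ind-· : ∀ {g h} → G g → G h → ind {p} (g · h) ≡ ind {p} g · ind {p} h
  ind-· {g} {h} Gg Gh = ext λ i → begin
    ind {p} (g · h) $ i         ≡⟨ ind-at (mul∈ g h Gg Gh) i 0F ⟨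
    blk ((g · h) $ at i 0F)     ≡⟨ cong blk (·-$ g h _) ⟩
    blk (g $ (h $ at i 0F))     ≡⟨ ind-blk Gg _ ⟩
    ind {p} g $ blk (h $ at i 0F) ≡⟨ cong (ind {p} g $_) (ind-at Gh i 0F) ⟩
    ind {p} g $ (ind {p} h $ i) ≡⟨ ·-$ (ind {p} g) (ind {p} h) i ⟨
    (ind {p} g · ind {p} h) $ i ∎
    where open ≡-Reasoning

  inverse : ∀ {g} → G g → Map (p * 3)
  inverse Gg = proj₁ (inv∈ _ Gg)

  G-inverse : ∀ {g} (Gg : G g) → G (inverse Gg)
  G-inverse Gg = proj₁ (proj₂ (inv∈ _ Gg))

  inverseʳ : ∀ {g} (Gg : G g) → g · inverse Gg ≡ idP
  inverseʳ Gg = proj₁ (proj₂ (proj₂ (inv∈ _ Gg)))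

  inverse-$ : ∀ {g} (Gg : G g) x → inverse Gg $ (g $ x) ≡ x
  inverse-$ {g} Gg x = trans (sym (·-$ (inverse Gg) g x))
    (trans (cong (_$ x) (proj₂ (proj₂ (proj₂ (inv∈ _ Gg))))) (id-$ x))

  undo : ∀ {g} (Gg : G g) σ → g · (inverse Gg · σ) ≡ σ
  undo {g} Gg σ = trans (sym (·-assoc g (inverse Gg) σ)) (trans (cong (_· σ) (inverseʳ Gg)) (·-idˡ σ))

  -- The source of the coset arguments: on the blocks `g` and `h` are equal, so `g` inverse undoes
  -- `h` there.
  quotient∈K : ∀ {g h} (Gg : G g) → G h → (∀ x → blk (g $ x) ≡ blk (h $ x)) → K (inverse Gg · h)
  quotient∈K {g} {h} Gg Gh same = mul∈ _ _ (G-inverse Gg) Gh , λ x → begin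
    blk ((inverse Gg · h) $ x)            ≡⟨ cong blk (·-$ (inverse Gg) h x) ⟩
    blk (inverse Gg $ (h $ x))            ≡⟨ ind-blk {inverse Gg} (G-inverse Gg) _ ⟩
    ind {p} (inverse Gg) $ blk (h $ x)    ≡⟨ cong (ind {p} (inverse Gg) $_) (same x) ⟨
    ind {p} (inverse Gg) $ blk (g $ x)    ≡⟨ ind-blk {inverse Gg} (G-inverse Gg) _ ⟨
    blk (inverse Gg $ (g $ x))            ≡⟨ cong blk (inverse-$ Gg x) ⟩
    blk x                                 ∎
    where open ≡-Reasoning

  quotient-fixes : ∀ {g} (Gg : G g) h {x} → g $ x ≡ h $ x → (inverse Gg · h) $ x ≡ x
  quotient-fixes {g} Gg h {x} q = trans (·-$ (inverse Gg) h x)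
    (trans (cong (inverse Gg $_) (sym q)) (inverse-$ Gg x))

  K-· : ∀ {σ τ} → K σ → K τ → K (σ · τ)
  K-· {σ} {τ} (Gσ , fσ) (Gτ , fτ) = mul∈ σ τ Gσ Gτ ,
    λ x → trans (cong blk (·-$ σ τ x)) (trans (fσ _) (fτ x))

  K-id : K idP
  K-id = id∈ , λ x → cong blk (id-$ x)

  -- Action on the labels of a block.

  local : ∀ {g} → G g → ∀ i → ∃[ ε ] ∃[ c ] (∀ l → g $ at i l ≡ at (ind {p} g $ i) (act ε c l))
  local {g} Gg i =
    let ε , c , q₀ , q₁ , q₂ = act-classify (f 0F) (f 1F) (f 2F) (f-inj λ ()) (f-inj λ ()) (f-inj λ ())
    in ε , c , λ { 0F → trans (f-eq 0F) (cong (at _) q₀)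
                 ; 1F → trans (f-eq 1F) (cong (at _) q₁)
                 ; 2F → trans (f-eq 2F) (cong (at _) q₂) }
    where
    f : Fin 3 → Fin 3
    f l = proj₂ (Fin.remQuot {p} 3 (g $ at i l))
    f-eq : ∀ l → g $ at i l ≡ at (ind {p} g $ i) (f l)
    f-eq l = trans (sym (Fin.combine-remQuot {p} 3 _)) (cong (λ j → at j (f l)) (ind-at Gg i l))
    f-inj : ∀ {k l} → k ≢ l → f k ≢ f l
    f-inj {k} {l} k≢l q = k≢l (at-injectiveʳ (perm g Gg _ _
      (trans (f-eq k) (trans (cong (at _) q) (sym (f-eq l))))))

  local-K : ∀ {σ} → K σ → ∀ i → ∃[ ε ] ∃[ c ] (∀ l → σ $ at i l ≡ at i (act ε c l))
  local-K {σ} (Gσ , fix) i = let ε , c , q = local Gσ i in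
    ε , c , λ l → trans (q l) (cong (λ j → at j (act ε c l))
      (trans (sym (ind-at Gσ i 0F)) (trans (fix _) (blk-at i 0F))))

  -- A reflection on some block would make σ³ an involution.
  K-even : ∀ {σ} → K σ → ∀ i → ∃[ c ] (∀ l → σ $ at i l ≡ at i (c ⊕ l))
  K-even {σ} Kσ i = let ε , c , q = local-K Kσ i in
      c , λ l → trans (q l) (cong (λ δ → at i (act δ c l)) (even ε c q))
    where
    τ = σ · (σ · σ)
    Kτ : K τ
    Kτ = K-· {σ} {σ · σ} Kσ (K-· {σ} {σ} Kσ Kσ)
    cube : ∀ x → τ $ x ≡ σ $ (σ $ (σ $ x))
    cube x = trans (·-$ σ (σ · σ) x) (cong (σ $_) (·-$ σ σ x))
    cube-local : ∀ i ε c → (∀ l → σ $ at i l ≡ at i (act ε c l)) → ∀ l →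
      let f = act ε c in τ $ at i l ≡ at i (f (f (f l)))
    cube-local i ε c q l = trans (cube _) (trans (cong (λ x → σ $ (σ $ x)) (q l))
      (trans (cong (σ $_) (q _)) (q _)))
    -- The square of `τ` is the sixth power of `σ`, and Sym(3) has exponent dividing 6.
    square : ∀ i l → τ $ (τ $ at i l) ≡ at i l
    square i l = let ε , c , q = local-K Kσ i in trans (cong (τ $_) (cube-local i ε c q l))
      (trans (cube-local i ε c q _) (cong (at i) (act-sixth ε c l)))
    τ≡id : τ ≡ idP
    τ≡id = K-no-involution τ Kτ (ext λ x → trans (·-$ τ τ x)
      (trans (everywhere (λ x → τ $ (τ $ x) ≡ x) (λ n → square (res n)) x) (sym (id-$ x))))
    even : ∀ ε c → (∀ l → σ $ at i l ≡ at i (act ε c l)) → ε ≡ 0F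
    even ε c q = act-cubed ε c λ l → at-injectiveʳ (trans (sym (cube-local i ε c q l))
      (trans (cong (_$ at i l) τ≡id) (id-$ _)))

  -- The generators `a` and `b` in coordinates.

  a-res : ∀ n l → a $ at (res n) l ≡ at (res (suc n)) l
  a-res n l = trans (a-acts _ l) (cong (λ i → at i l) (sucMod-res n))

  pow-a-res : ∀ k n l → pow a k $ at (res n) l ≡ at (res (k + n)) l
  pow-a-res zero    n l = id-$ _
  pow-a-res (suc k) n l = trans (·-$ a (pow a k) _) (trans (cong (a $_) (pow-a-res k n l)) (a-res _ l))

  G-pow : ∀ {g} → G g → ∀ k → G (pow g k)
  G-pow Gg zero    = id∈
  G-pow Gg (suc k) = mul∈ _ _ Gg (G-pow Gg k)

  alpha-res : ∀ n → alpha {p} $ res n ≡ res (suc n)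
  alpha-res n = trans (Vec.lookup∘tabulate sucMod (res n)) (sucMod-res n)

  pow-alpha-res : ∀ k n → pow (alpha {p}) k $ res n ≡ res (k + n)
  pow-alpha-res zero    n = id-$ _
  pow-alpha-res (suc k) n = trans (·-$ alpha (pow alpha k) _)
    (trans (cong (alpha $_) (pow-alpha-res k n)) (alpha-res _))

  -- Block 0 is fixed, and the relation between `b` and `alpha` carries the formula from `n` to
  -- `n + 1`.
  ind-b-res : ∀ n → ind {p} b $ res n ≡ res (t * n)
  ind-b-res zero = trans (cong (ind {p} b $_) (sym fz-res))
    (trans b-fixes (trans fz-res (cong res (sym (ℕ.*-zeroʳ t)))))
  ind-b-res (suc n) = begin
    ind {p} b $ res (suc n)              ≡⟨ cong (ind {p} b $_) (alpha-res n) ⟨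
    ind {p} b $ (alpha $ res n)          ≡⟨ ·-$ (ind {p} b) alpha _ ⟨
    (ind {p} b · alpha) $ res n          ≡⟨ cong (_$ res n) b-rel ⟩
    (pow alpha t · ind {p} b) $ res n    ≡⟨ ·-$ (pow alpha t) (ind {p} b) _ ⟩
    pow alpha t $ (ind {p} b $ res n)    ≡⟨ cong (pow alpha t $_) (ind-b-res n) ⟩
    pow alpha t $ res (t * n)            ≡⟨ pow-alpha-res t _ ⟩
    res (t + t * n)                      ≡⟨ cong res (ℕ.*-suc t n) ⟨
    res (t * suc n)                      ∎
    where open ≡-Reasoning

  pow-ind-b-res : ∀ k n → pow (ind {p} b) k $ res n ≡ res (t ^ k * n)
  pow-ind-b-res zero    n = trans (id-$ _) (cong res (sym (ℕ.*-identityˡ n)))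
  pow-ind-b-res (suc k) n = trans (·-$ (ind {p} b) (pow (ind {p} b) k) _)
    (trans (cong (ind {p} b $_) (pow-ind-b-res k n))
    (trans (ind-b-res _) (cong res (sym (ℕ.*-assoc t (t ^ k) n)))))

  t-order : t ^ d ~ 1
  t-order = subst (_~ 1) (ℕ.*-identityʳ (t ^ d)) (res-injective
    (trans (sym (pow-ind-b-res d 1)) (trans (cong (_$ res 1) (proj₁ (proj₂ b-order))) (id-$ _))))

  -- If `t ^ k ~ 1`, the `k`-th power of the induced map of `b` fixes every block, against its
  -- order.
  t-minimal : ∀ k → 0 < k → k < d → ¬ (t ^ k ~ 1)
  t-minimal k 0<k k<d h = proj₂ (proj₂ b-order) k 0<k k<d (ext λ i → begin
    pow (ind {p} b) k $ i              ≡⟨ cong (pow (ind {p} b) k $_) (res-toℕ i) ⟨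
    pow (ind {p} b) k $ res (toℕ i)    ≡⟨ pow-ind-b-res k (toℕ i) ⟩
    res (t ^ k * toℕ i)                ≡⟨ res-cong (~-* {t ^ k} {1} {toℕ i} h refl) ⟩
    res (1 * toℕ i)                    ≡⟨ cong res (ℕ.*-identityˡ (toℕ i)) ⟩
    res (toℕ i)                        ≡⟨ res-toℕ i ⟩
    i                                  ≡⟨ id-$ i ⟨
    idP $ i                            ∎)
    where open ≡-Reasoning

  -- b a and aᵗ b agree modulo K, which is even, so the parity of b is the same on
  -- consecutive blocks.
  b-odd : ∀ n → ∃[ c ] (∀ l → b $ at (res n) l ≡ at (res (t * n)) (act 1F c l))
  b-odd n = let ε , c , q = local Gb (res n) in c , λ l → trans (q l)
      (cong₂ (λ i δ → at i (act δ c l)) (ind-b-res n) (odd n ε c q))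
    where
    -- Block 0 is the one on which `b` exchanges two labels.
    base : ∀ ε c → (∀ l → b $ at (res 0) l ≡ at (ind {p} b $ res 0) (act ε c l)) → ε ≡ 1F
    base ε c q = let j , k , j≢k , qj , qk = b-swaps in
      swap-odd ε c j k j≢k
        (at-injectiveʳ (trans (sym (q j)) (subst (λ i → b $ at i j ≡ at i k) fz-res qj)))
        (at-injectiveʳ (trans (sym (q k)) (subst (λ i → b $ at i k ≡ at i j) fz-res qk)))
    odd : ∀ n ε c → (∀ l → b $ at (res n) l ≡ at (ind {p} b $ res n) (act ε c l)) → ε ≡ 1F
    odd zero = base
    odd (suc n) ε c q = trans (sym (⊻-idʳ ε)) (act-parity (ε ⊻ 0F) 1F (act ε c c₁) c₀ λ l →
        at-injectiveʳ (trans (sym (lhs l)) (rhs l)))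
      where
      ε₀ = proj₁ (local Gb (res n))
      c₀ = proj₁ (proj₂ (local Gb (res n)))
      q₀ = proj₂ (proj₂ (local Gb (res n)))
      g = b · a
      h = pow a t · b
      Gg = mul∈ b a Gb Ga
      Gh = mul∈ (pow a t) b (G-pow Ga t) Gb
      g-at : ∀ m l → g $ at (res m) l ≡ b $ at (res (suc m)) l
      g-at m l = trans (·-$ b a _) (cong (b $_) (a-res m l))
      h-at : ∀ m l → ∀ {k} → b $ at (res m) l ≡ at (ind {p} b $ res m) k →
        h $ at (res m) l ≡ at (res (t + t * m)) k
      h-at m l {k} r = trans (·-$ (pow a t) b _) (trans (cong (pow a t $_) (trans r
        (cong (λ i → at i k) (ind-b-res m)))) (pow-a-res t _ k))
      same : ∀ x → blk (g $ x) ≡ blk (h $ x)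
      same = everywhere (λ x → blk (g $ x) ≡ blk (h $ x)) λ m l → begin
        blk (g $ at (res m) l)          ≡⟨ cong blk (g-at m l) ⟩
        blk (b $ at (res (suc m)) l)    ≡⟨ ind-at Gb _ l ⟩
        ind {p} b $ res (suc m)         ≡⟨ ind-b-res (suc m) ⟩
        res (t * suc m)                 ≡⟨ cong res (ℕ.*-suc t m) ⟩
        res (t + t * m)                 ≡⟨ blk-at _ _ ⟨
        blk (at (res (t + t * m)) _)    ≡⟨ cong blk (h-at m l (proj₂ (proj₂ (local Gb (res m))) l)) ⟨
        blk (h $ at (res m) l)          ∎
        where open ≡-Reasoning
      -- Since `h = g · k` with `k` even, `h` has on block `n` the sign of `b` on block `n + 1`. As
      -- `a` preserves labels, `h` also has there the sign of `b` on block `n`.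
      k = inverse Gg · h
      k-even = K-even {k} (quotient∈K Gg Gh same) (res n)
      c₁ = proj₁ k-even
      lhs : ∀ l → h $ at (res n) l ≡ at (ind {p} b $ res (suc n)) (act (ε ⊻ 0F) (act ε c c₁) l)
      lhs l = begin
        h $ at (res n) l                              ≡⟨ cong (_$ at (res n) l) (undo Gg h) ⟨
        (g · k) $ at (res n) l                        ≡⟨ ·-$ g k _ ⟩
        g $ (k $ at (res n) l)                        ≡⟨ cong (g $_) (proj₂ k-even l) ⟩
        g $ at (res n) (c₁ ⊕ l)                       ≡⟨ g-at n _ ⟩
        b $ at (res (suc n)) (c₁ ⊕ l)                 ≡⟨ q _ ⟩
        at _ (act ε c (act 0F c₁ l))                  ≡⟨ cong (at _) (act-∘ ε 0F c c₁ l) ⟩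
        at _ (act (ε ⊻ 0F) (act ε c c₁) l)            ∎
        where open ≡-Reasoning
      rhs : ∀ l → h $ at (res n) l ≡ at (res (t + t * n)) (act 1F c₀ l)
      rhs l = h-at n l (trans (q₀ l) (cong (λ δ → at _ (act δ c₀ l)) (odd n ε₀ c₀ q₀)))

  -- Classes of affine elements.

  Affine : ℕ → ℕ → Map (p * 3) → Set
  Affine j γ g = ∀ n → ∃[ c ] (∀ l → g $ at (res n) l ≡ at (res (γ + t ^ j * n)) (act (parity j) c l))

  -- The class is the exponent of the image of `b` in the action on the blocks, meaningful modulo
  -- `d`. The label constant may vary with the block, the sign may not.
  Class : ℕ → Map (p * 3) → Set
  Class j g = ∃[ γ ] Affine j γ g

  Affine-K : ∀ {σ} → K σ → Affine 0 0 σ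
  Affine-K {σ} Kσ n = let c , q = K-even {σ} Kσ (res n) in
    c , λ l → trans (q l) (cong (λ m → at (res m) (c ⊕ l)) (sym (ℕ.*-identityˡ n)))

  Affine-a : Affine 0 1 a
  Affine-a n = 0F , λ l → trans (a-res n l) (cong (λ m → at (res (suc m)) l) (sym (ℕ.*-identityˡ n)))

  Affine-b : Affine 1 0 b
  Affine-b n = let c , q = b-odd n in
    c , λ l → trans (q l) (cong (λ u → at (res (u * n)) (act 1F c l)) (sym (ℕ.*-identityʳ t)))

  -- Slopes multiply on the blocks while signs add on the labels, and both follow the sum of the
  -- exponents.
  Affine-· : ∀ {i j γ δ g h} → Affine i γ g → Affine j δ h → Affine (i + j) (γ + t ^ i * δ) (g · h)
  Affine-· {i} {j} {γ} {δ} {g} {h} A B n =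
    let c , q = B n ; c′ , q′ = A (δ + t ^ j * n) in act (parity i) c′ c , λ l → begin
    (g · h) $ at (res n) l
      ≡⟨ ·-$ g h _ ⟩
    g $ (h $ at (res n) l)
      ≡⟨ cong (g $_) (q l) ⟩
    g $ at (res (δ + t ^ j * n)) (act (parity j) c l)
      ≡⟨ q′ _ ⟩
    at (res (γ + t ^ i * (δ + t ^ j * n))) (act (parity i) c′ (act (parity j) c l))
      ≡⟨ cong₂ at (cong res (blocks γ (t ^ i) δ (t ^ j) n)) (act-∘ (parity i) (parity j) c′ c l) ⟩
    at (res (γ + t ^ i * δ + t ^ i * t ^ j * n)) (act (parity i ⊻ parity j) (act (parity i) c′ c) l)
      ≡⟨ cong₂ (λ u ε → at (res (γ + t ^ i * δ + u * n)) (act ε (act (parity i) c′ c) l))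
           (ℕ.^-distribˡ-+-* t i j) (parity-+ i j) ⟨
    at (res (γ + t ^ i * δ + t ^ (i + j) * n)) (act (parity (i + j)) (act (parity i) c′ c) l) ∎
    where
    open ≡-Reasoning
    blocks : ∀ γ u δ v n → γ + u * (δ + v * n) ≡ γ + u * δ + u * v * n
    blocks = solve-∀

  -- The slope is unchanged because `t ^ d ~ 1`, and the sign because `d` is even.
  Affine-shift : ∀ {j γ g} q → Affine (j + q * d) γ g → Affine j γ g
  Affine-shift {j} {γ} {g} q A n = let c , r = A n in c , λ l → trans (r l) (cong₂ (λ i ε → at i (act ε c l))
      (res-cong (~-+ {γ} {γ} refl (~-* {t ^ (j + q * d)} {t ^ j} {n} {n} power refl))) par)
    where
    power-q : ∀ q → t ^ (q * d) ~ 1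
    power-q zero    = refl
    power-q (suc q) = trans (≡⇒~ (ℕ.^-distribˡ-+-* t d (q * d)))
      (~-* {t ^ d} {1} {t ^ (q * d)} {1} t-order (power-q q))
    power : t ^ (j + q * d) ~ t ^ j
    power = trans (≡⇒~ (ℕ.^-distribˡ-+-* t j (q * d)))
      (trans (~-* {t ^ j} {t ^ j} {t ^ (q * d)} {1} refl (power-q q)) (≡⇒~ (ℕ.*-identityʳ (t ^ j))))
    par : parity (j + q * d) ≡ parity j
    par = trans (parity-+ j (q * d)) (trans (cong (parity j ⊻_)
      (trans (cong parity (sym (ℕ.*-assoc q e 2))) (parity-*2 (q * e)))) (⊻-idʳ (parity j)))

  H-affine : ∀ {g} → H g → ∃[ j ] Class j g
  H-affine (gen σ (inj₁ Kσ))        = 0 , 0 , Affine-K {σ} Kσ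
  H-affine (gen σ (inj₂ (inj₁ refl))) = 0 , 1 , Affine-a
  H-affine (gen σ (inj₂ (inj₂ refl))) = 1 , 0 , Affine-b
  H-affine one                      = 0 , 0 , Affine-K {idP} K-id
  H-affine (mul σ τ Hσ Hτ) = let i , γ , A = H-affine Hσ ; j , δ , B = H-affine Hτ in
    i + j , γ + t ^ i * δ , Affine-· {i} {j} {γ} {δ} {σ} {τ} A B

  H⊆G : ∀ {g} → H g → G g
  H⊆G (gen σ (inj₁ (Gσ , _)))     = Gσ
  H⊆G (gen σ (inj₂ (inj₁ refl)))  = Ga
  H⊆G (gen σ (inj₂ (inj₂ refl)))  = Gb
  H⊆G one                         = id∈
  H⊆G (mul σ τ Hσ Hτ)             = mul∈ σ τ (H⊆G Hσ) (H⊆G Hτ)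

  bar-lift : ∀ {σ} → Gen (λ τ → τ ≡ alpha ⊎ τ ≡ ind {p} b) σ → ∃[ h ] (H h × ind {p} h ≡ σ)
  bar-lift (gen σ (inj₁ refl)) = a , gen a (inj₂ (inj₁ refl)) ,
    ext λ i → trans (sym (ind-at Ga i 0F)) (trans (cong blk (a-acts i 0F))
      (trans (blk-at _ 0F) (sym (Vec.lookup∘tabulate sucMod i))))
  bar-lift (gen σ (inj₂ refl)) = b , gen b (inj₂ (inj₂ refl)) , refl
  bar-lift one = idP , one , ext λ i → trans (sym (ind-at id∈ i 0F))
    (trans (cong blk (id-$ (at i 0F))) (trans (blk-at i 0F) (sym (id-$ i))))
  bar-lift (mul σ τ Sσ Sτ) = let g , Hg , r = bar-lift Sσ ; h , Hh , s = bar-lift Sτ in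
    g · h , mul g h Hg Hh , trans (ind-· (H⊆G Hg) (H⊆G Hh)) (cong₂ _·_ r s)

  -- The block action of `g` is a word in `alpha` and the image of `b`. The same word in `a` and `b`
  -- differs from `g` by an element of `K`.
  G⊆H : ∀ {g} → G g → H g
  G⊆H {g} Gg = let h , Hh , r = bar-lift (bar-gen _ (g , Gg , refl)) ; Gh = H⊆G Hh in
    subst H (undo Gh g) (mul h _ Hh (gen _ (inj₁ (quotient∈K Gh Gg λ x →
      trans (ind-blk Gh x) (trans (cong (_$ blk x) r) (sym (ind-blk Gg x)))))))

  0<d : 0 < d
  0<d = proj₁ b-order

  -- This is `2 i + r`: the classes below `d` are sorted by parity `r`, with `e` classes of each
  -- parity.
  index : Fin e → Fin 2 → ℕ
  index i r = toℕ (Fin.combine i r)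

  index<d : ∀ i r → index i r < d
  index<d i r = Fin.toℕ<n (Fin.combine i r)

  parity-index : ∀ i r → parity (index i r) ≡ r
  parity-index i r = trans (cong parity (Fin.toℕ-combine i r)) (trans (parity-+ (2 * toℕ i) (toℕ r))
      (trans (cong (_⊻ parity (toℕ r)) (trans (cong parity (ℕ.*-comm 2 (toℕ i))) (parity-*2 (toℕ i))))
        (small r)))
    where
    small : ∀ r → parity (toℕ {2} r) ≡ r
    small 0F = refl
    small 1F = refl

  class : ∀ {g} → G g → ∃[ j ] Class (toℕ {d} j) g
  class {g} Gg = reduce (H-affine (G⊆H Gg))
    where
    instance
      d-nonZero : NonZero d
      d-nonZero = ℕ.>-nonZero 0<d
    reduce : ∃[ j ] Class j g → ∃[ j ] Class (toℕ {d} j) g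
    reduce (j , γ , A) = Fin.fromℕ< j%d<d , γ , subst (λ i → Affine i γ g) (sym (Fin.toℕ-fromℕ< j%d<d))
        (Affine-shift {j % d} {γ} {g} (j / d)
          (subst (λ i → Affine i γ g) (DivMod.m≡m%n+[m/n]*n j d) A))
      where
      j%d<d = DivMod.m%n<n j d

  class-index : ∀ {g} → G g → ∃[ r ] ∃[ i ] Class (index i r) g
  class-index {g} Gg = let j , C = class Gg ; i , r , q = Fin.combine-surjective {e} {2} j in
    r , i , subst (λ j → Class (toℕ j) g) (sym q) C

  -- Agreement of two elements at a point.

  meet-res : ∀ {i j γ δ g h} → Affine i γ g → Affine j δ h → ∀ {n l} →
    g $ at (res n) l ≡ h $ at (res n) l → γ + t ^ i * n ~ δ + t ^ j * n
  meet-res A B {n} {l} q = res-injective (at-injectiveˡ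
    (trans (sym (proj₂ (A n) l)) (trans q (proj₂ (B n) l))))

  meet-constant : ∀ {j γ δ g h} → Affine j γ g → Affine j δ h → ∀ {n l} →
    g $ at (res n) l ≡ h $ at (res n) l → γ ~ δ
  meet-constant {j} {γ} {δ} {g} {h} A B {n} q = ~-cancelˡ (t ^ j * n)
    (subst₂ _~_ (ℕ.+-comm γ _) (ℕ.+-comm δ _) (meet-res {j} {j} {γ} {δ} {g} {h} A B q))

  -- With equal slopes, agreement on one block forces the constants `γ` and `δ` to be congruent.
  meet-same-blk : ∀ {j g h} → Class j g → Class j h → ∀ {x} → g $ x ≡ h $ x →
    ∀ y → blk (g $ y) ≡ blk (h $ y)
  meet-same-blk {j} {g} {h} (γ , A) (δ , B) {x} = everywhere
    (λ x → g $ x ≡ h $ x → ∀ y → blk (g $ y) ≡ blk (h $ y))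
    (λ n l q → everywhere (λ y → blk (g $ y) ≡ blk (h $ y)) λ m k → begin
      blk (g $ at (res m) k)            ≡⟨ cong blk (proj₂ (A m) k) ⟩
      blk (at (res (γ + t ^ j * m)) _)  ≡⟨ blk-at _ _ ⟩
      res (γ + t ^ j * m)               ≡⟨ res-cong (~-+ {γ} {δ} {t ^ j * m}
                                             (meet-constant {j} {γ} {δ} {g} {h} A B q) refl) ⟩
      res (δ + t ^ j * m)               ≡⟨ blk-at _ _ ⟨
      blk (at (res (δ + t ^ j * m)) _)  ≡⟨ cong blk (proj₂ (B m) k) ⟨
      blk (h $ at (res m) k)            ∎) x
    where open ≡-Reasoning

  -- With equal signs, one common value forces equal label constants on that block.
  meet-block : ∀ {i j g h} → parity i ≡ parity j → Class i g → Class j h → ∀ {n l} →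
    g $ at (res n) l ≡ h $ at (res n) l → ∀ k → g $ at (res n) k ≡ h $ at (res n) k
  meet-block {i} {j} {g} {h} par (γ , A) (δ , B) {n} {l} q k =
    trans (proj₂ (A n) k) (trans (cong₂ at (at-injectiveˡ both)
      (trans (cong (λ ε → act ε (proj₁ (A n)) k) par) (cong (λ c → act (parity j) c k) same-c)))
      (sym (proj₂ (B n) k)))
    where
    both : at (res (γ + t ^ i * n)) (act (parity i) (proj₁ (A n)) l)
         ≡ at (res (δ + t ^ j * n)) (act (parity j) (proj₁ (B n)) l)
    both = trans (sym (proj₂ (A n) l)) (trans q (proj₂ (B n) l))
    same-c : proj₁ (A n) ≡ proj₁ (B n)
    same-c = act-constant (parity j) _ _ l
      (trans (cong (λ ε → act ε (proj₁ (A n)) l) (sym par)) (at-injectiveʳ both))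

  -- An element agrees with itself on blocks 0 and 1, whereas distinct slopes would allow agreement
  -- on one block only.
  class-unique : ∀ {i j g} → i < d → j < d → Class i g → Class j g → i ≡ j
  class-unique {i} {j} {g} i<d j<d (γ , A) (δ , B) = decidable-stable (i ℕ.≟ j) λ i≢j →
    0≁1 (meet-unique pr t-order t-minimal i≢j i<d j<d γ δ
      (meet-res {i} {j} {γ} {δ} {g} {g} A B {0} {0F} refl) (meet-res {i} {j} {γ} {δ} {g} {g} A B {1} {0F} refl))

  class-coset : ∀ {j g σ} → Class j g → K σ → Class j (g · σ)
  class-coset {j} {g} {σ} (γ , A) Kσ = γ + t ^ j * 0 ,
    subst (λ i → Affine i (γ + t ^ j * 0) (g · σ)) (ℕ.+-identityʳ j)
      (Affine-· {j} {0} {γ} {0} {g} {σ} A (Affine-K {σ} Kσ))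

  -- Stabilisers

  -- Some element of `K` moves a point `x`. Conjugating it by an element of `G` that takes the given
  -- point to `x` gives one that moves the given point, and by evenness it is a non-zero translation
  -- of that block.
  K-moves : ∀ n → ∃[ σ ] (K σ × ∃[ c ] (c ≢ 0F × ∀ l → σ $ at (res n) l ≡ at (res n) (c ⊕ l)))
  K-moves n = κ , Kκ , c , c≢0 , q
    where
    y = at (res n) 0F
    Moved : Set
    Moved = ∃[ σ ] (K σ × ∃[ x ] σ $ x ≢ x)
    moved : Moved
    moved = stable Moved λ none → K-nontrivial λ σ Kσ → ext λ x → trans
      (decidable-stable (σ $ x Fin.≟ x) λ σx≢x → none (σ , Kσ , x , σx≢x)) (sym (id-$ x))
    σ = proj₁ moved
    Kσ = proj₁ (proj₂ moved)
    x = proj₁ (proj₂ (proj₂ moved))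
    σx≢x = proj₂ (proj₂ (proj₂ moved))
    g = proj₁ (transitive y x)
    Gg = proj₁ (proj₂ (transitive y x))
    gy = proj₂ (proj₂ (transitive y x))
    κ = inverse Gg · (σ · g)
    Kκ : K κ
    Kκ = quotient∈K Gg (mul∈ σ g (proj₁ Kσ) Gg) λ z →
      sym (trans (cong blk (·-$ σ g z)) (proj₂ Kσ _))
    κy≢y : κ $ y ≢ y
    κy≢y κy = σx≢x (begin
      σ $ x                  ≡⟨ cong (σ $_) gy ⟨
      σ $ (g $ y)            ≡⟨ ·-$ σ g y ⟨
      (σ · g) $ y            ≡⟨ cong (_$ y) (undo Gg (σ · g)) ⟨
      (g · κ) $ y            ≡⟨ ·-$ g κ y ⟩
      g $ (κ $ y)            ≡⟨ cong (g $_) κy ⟩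
      g $ y                  ≡⟨ gy ⟩
      x                      ∎)
      where open ≡-Reasoning
    c = proj₁ (K-even {κ} Kκ (res n))
    q = proj₂ (K-even {κ} Kκ (res n))
    c≢0 : c ≢ 0F
    c≢0 c≡0 = κy≢y (trans (q 0F) (cong (λ c → at (res n) (c ⊕ 0F)) c≡0))

  -- The identity, `κ` and its square suffice, as a non-zero translation generates ℤ/3.
  K-transitive : ∀ n l → ∃[ σ ] (K σ × σ $ at (res n) 0F ≡ at (res n) l)
  K-transitive n l =
    let κ , Kκ , c , c≢0 , q = K-moves n in
    [ (λ l≡0 → idP , K-id , trans (id-$ _) (cong (at (res n)) (sym l≡0))) ,
      [ (λ l≡c → κ , Kκ , trans (q 0F) (cong (at (res n)) (trans (⊕-idʳ c) (sym l≡c)))) ,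
        (λ l≡2c → κ · κ , K-· {κ} {κ} Kκ Kκ , trans (·-$ κ κ _) (trans (cong (κ $_) (q 0F))
          (trans (q _) (cong (at (res n)) (trans (cong (c ⊕_) (⊕-idʳ c)) (sym l≡2c)))))) ]′ ]′
    (translation-orbit c c≢0 l)

  Kfix : ℕ → PSet (p * 3)
  Kfix n σ = K σ × σ $ at (res n) 0F ≡ at (res n) 0F

  -- Orbit-stabiliser for `K` on block `n`: the representative `u l` takes label 0 to `l`.
  size-K : ∀ n {s} → HasSize (Kfix n) s → HasSize K (3 * s)
  size-K n sz = size-cosets sz u (λ l → perm _ (Gu l)) distinct covers
    where
    y = at (res n) 0F
    u : Fin 3 → Map (p * 3)
    u l = proj₁ (K-transitive n l)
    Ku : ∀ l → K (u l)
    Ku l = proj₁ (proj₂ (K-transitive n l))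
    Gu : ∀ l → G (u l)
    Gu l = proj₁ (Ku l)
    uy : ∀ l → u l $ y ≡ at (res n) l
    uy l = proj₂ (proj₂ (K-transitive n l))
    image : ∀ l σ → σ $ y ≡ y → (u l · σ) $ y ≡ at (res n) l
    image l σ fix = trans (·-$ (u l) σ y) (trans (cong (u l $_) fix) (uy l))
    distinct : ∀ k l σ τ → Kfix n σ → Kfix n τ → u k · σ ≡ u l · τ → k ≡ l
    distinct k l σ τ (_ , fσ) (_ , fτ) q = at-injectiveʳ
      (trans (sym (image k σ fσ)) (trans (cong (_$ y) q) (image l τ fτ)))
    covers : ∀ σ → K σ ⇔ (∃[ l ] ∃[ τ ] (Kfix n τ × σ ≡ u l · τ))
    covers σ = mk⇔ split λ { (l , τ , (Kτ , _) , refl) → K-· {u l} {τ} (Ku l) Kτ }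
      where
      split : K σ → ∃[ l ] ∃[ τ ] (Kfix n τ × σ ≡ u l · τ)
      split Kσ = let c , q = K-even {σ} Kσ (res n) in c , inverse (Gu c) · σ ,
        (quotient∈K (Gu c) (proj₁ Kσ) (λ x → trans (proj₂ (Ku c) x) (sym (proj₂ Kσ x))) ,
         quotient-fixes (Gu c) σ (trans (uy c) (sym (trans (q 0F) (cong (at (res n)) (⊕-idʳ c)))))) ,
        sym (undo (Gu c) σ)

  Kfix-sized : ∀ n → ∃[ s ] HasSize (Kfix n) s
  Kfix-sized n = hasSize λ σ → em (Kfix n σ)

  ∣K₀∣ : ℕ
  ∣K₀∣ = proj₁ (Kfix-sized 0)

  -- Three times the order of each such stabiliser is the order of `K`, so the order does not depend
  -- on the block.
  size-Kfix : ∀ n → HasSize (Kfix n) ∣K₀∣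
  size-Kfix n = let s , sz = Kfix-sized n in subst (HasSize (Kfix n)) (ℕ.*-cancelˡ-≡ _ _ 3
    (size-unique (size-K n sz) (size-K 0 (proj₂ (Kfix-sized 0))))) sz

  ω : Fin (p * 3)
  ω = at (res 0) 0F

  Stab : PSet (p * 3)
  Stab σ = H σ × σ $ ω ≡ ω

  -- The stabiliser contains one coset of `Kfix 0` for each of the `d` classes.
  size-Stab : HasSize Stab (d * ∣K₀∣)
  size-Stab = size-cosets (size-Kfix 0) u (λ j → perm _ (Gu j)) distinct covers
    where
    b-block : ∀ l → ∃[ k ] b $ at (res 0) l ≡ at (res 0) k
    b-block l = let c , q = b-odd 0 in
      act 1F c l , trans (q l) (cong (λ m → at (res m) (act 1F c l)) (ℕ.*-zeroʳ t))
    power-block : ∀ k → ∃[ l ] pow b k $ ω ≡ at (res 0) l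
    power-block zero    = 0F , id-$ _
    power-block (suc k) = let l , q = power-block k ; m , r = b-block l in
      m , trans (·-$ b (pow b k) ω) (trans (cong (b $_) q) r)
    power-class : ∀ k → Class k (pow b k)
    power-class zero    = 0 , Affine-K {idP} K-id
    power-class (suc k) = let γ , A = power-class k in _ , Affine-· {1} {k} {0} {γ} {b} {pow b k} Affine-b A
    -- Powers of `b` keep block 0, where `K` is transitive, so an element of `K` can correct
    -- `pow b k` to fix `ω`.
    κ : ∀ k → ∃[ σ ] (K σ × σ $ ω ≡ pow b k $ ω)
    κ k = let l , q = power-block k ; σ , Kσ , r = K-transitive 0 l in σ , Kσ , trans r (sym q)
    u : Fin d → Map (p * 3)
    u j = inverse (proj₁ (proj₁ (proj₂ (κ (toℕ j))))) · pow b (toℕ j)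
    Gκ : ∀ j → G (proj₁ (κ (toℕ {d} j)))
    Gκ j = proj₁ (proj₁ (proj₂ (κ (toℕ j))))
    Gu : ∀ j → G (u j)
    Gu j = mul∈ _ _ (G-inverse (Gκ j)) (G-pow Gb (toℕ j))
    Kκ⁻¹ : ∀ j → K (inverse (Gκ j))
    Kκ⁻¹ j = subst K (ext λ x → trans (·-$ (inverse (Gκ j)) idP x) (cong (inverse (Gκ j) $_) (id-$ x)))
      (quotient∈K (Gκ j) id∈ λ x → trans (proj₂ (proj₁ (proj₂ (κ (toℕ j)))) x) (sym (cong blk (id-$ x))))
    u-fixes : ∀ j → u j $ ω ≡ ω
    u-fixes j = quotient-fixes (Gκ j) (pow b (toℕ j)) (proj₂ (proj₂ (κ (toℕ j))))
    u-class : ∀ j → Class (toℕ j) (u j)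
    u-class j = let γ , A = power-class (toℕ j) in
      _ , Affine-· {0} {toℕ j} {0} {γ} {inverse (Gκ j)} {pow b (toℕ j)} (Affine-K {inverse (Gκ j)} (Kκ⁻¹ j)) A
    distinct : ∀ i j σ τ → Kfix 0 σ → Kfix 0 τ → u i · σ ≡ u j · τ → i ≡ j
    distinct i j σ τ (Kσ , _) (Kτ , _) q = Fin.toℕ-injective
      (class-unique {g = u j · τ} (Fin.toℕ<n i) (Fin.toℕ<n j)
        (subst (Class (toℕ i)) q (class-coset {toℕ i} {u i} {σ} (u-class i) Kσ)) (class-coset {toℕ j} {u j} {τ} (u-class j) Kτ))
    covers : ∀ σ → Stab σ ⇔ (∃[ j ] ∃[ τ ] (Kfix 0 τ × σ ≡ u j · τ))
    covers σ = mk⇔ split λ { (j , τ , (Kτ , fτ) , refl) → G⊆H (mul∈ _ τ (Gu j) (proj₁ Kτ)) ,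
        trans (·-$ (u j) τ ω) (trans (cong (u j $_) fτ) (u-fixes j)) }
      where
      split : Stab σ → ∃[ j ] ∃[ τ ] (Kfix 0 τ × σ ≡ u j · τ)
      split (Hσ , fσ) = let j , C = class (H⊆G Hσ) ; meet = trans (u-fixes j) (sym fσ) in
        j , inverse (Gu j) · σ ,
        (quotient∈K (Gu j) (H⊆G Hσ) (meet-same-blk {toℕ j} {u j} {σ} (u-class j) C meet) ,
         quotient-fixes (Gu j) σ meet) ,
        sym (undo (Gu j) σ)

  -- Intersecting families

  Meets : Map (p * 3) → Map (p * 3) → Set
  Meets g h = ∃[ x ] (g $ x ≡ h $ x)

  meets-res : ∀ {g h} → Meets g h → ∃[ n ] ∃[ l ] g $ at (res n) l ≡ h $ at (res n) l
  meets-res {g} {h} (x , q) = everywhere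
    (λ x → g $ x ≡ h $ x → ∃[ n ] ∃[ l ] g $ at (res n) l ≡ h $ at (res n) l) (λ n l r → n , l , r) x q

  -- Every member agrees somewhere with the head `g`, so all of them lie in the coset `gK`.
  one-class : ∀ j F → Unique F → (∀ {g} → g ∈ F → G g) → Intersecting F →
    (∀ {g} → g ∈ F → Class j g) → length F ≤ 3 * ∣K₀∣
  one-class j []        u GF meet CF = z≤n
  one-class j F@(g ∷ _) u GF meet CF = size-coset (size-K 0 (size-Kfix 0)) g (inverse Gg) (inverseʳ Gg) u λ {h} h∈ →
      quotient∈K Gg (GF h∈)
        (meet-same-blk {j} {g} {h} (CF (here refl)) (CF h∈) (proj₂ (meet g h (here refl) h∈)))
    where
    Gg = GF (here refl)

  -- An element of another class of the same parity meets every member of F in the same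
  -- block, and agrees with it on that whole block.
  two-classes : ∀ {i j g} → i ≢ j → i < d → j < d → parity i ≡ parity j → Class i g →
    ∀ F → Unique F → (∀ {h} → h ∈ F → G h) → Intersecting F →
    (∀ {h} → h ∈ F → Class j h) → (∀ {h} → h ∈ F → Meets g h) → length F ≤ ∣K₀∣
  two-classes i≢j i<d j<d par C [] u GF meet CF meet-g = z≤n
  two-classes {i} {j} {g} i≢j i<d j<d par C@(γ , A) F@(h ∷ _) u GF meet CF meet-g =
      size-coset (size-Kfix n₀) h (inverse Gh) (inverseʳ Gh) u λ {h′} h′∈ →
        quotient∈K Gh (GF h′∈)
          (meet-same-blk {j} {h} {h′} (CF (here refl)) (CF h′∈) (proj₂ (meet h h′ (here refl) h′∈))) ,
        quotient-fixes Gh h′ (trans (sym (agree-h 0F)) (agree h′ h′∈))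
    where
    Gh = GF (here refl)
    δ = proj₁ (CF (here refl))
    B = proj₂ (CF (here refl))
    n₀ = proj₁ (meets-res {g} {h} (meet-g (here refl)))
    q = proj₂ (proj₂ (meets-res {g} {h} (meet-g (here refl))))
    agree-h : ∀ k → g $ at (res n₀) k ≡ h $ at (res n₀) k
    agree-h = meet-block {i} {j} {g} {h} par C (CF (here refl)) q
    agree : ∀ h′ → h′ ∈ F → g $ at (res n₀) 0F ≡ h′ $ at (res n₀) 0F
    agree h′ h′∈ =
      let δ′ , B′ = CF h′∈
          n′ , l′ , q′ = meets-res {g} {h′} (meet-g h′∈)
          m , k , r = meets-res {h′} {h} (meet h′ h h′∈ (here refl))
          -- As `h` and `h′` agree somewhere, they act alike on the blocks, so both meet `g` on the
          -- same block.
          δ′~δ = meet-constant {j} {δ′} {δ} {h′} {h} B′ B r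
          n₀~n′ = meet-unique pr t-order t-minimal i≢j i<d j<d γ δ
            (meet-res {i} {j} {γ} {δ} {g} {h} A B q)
            (trans (meet-res {i} {j} {γ} {δ′} {g} {h′} A B′ q′) (~-+ {δ′} {δ} {t ^ j * n′} δ′~δ refl))
      in subst (λ i → g $ at i 0F ≡ h′ $ at i 0F) (sym (res-cong n₀~n′))
           (meet-block {i} {j} {g} {h′} par C (CF h′∈) q′ 0F)

  index-injective : ∀ {i i′ r} → index i r ≡ index i′ r → i ≡ i′
  index-injective {i} {i′} {r} q = Fin.combine-injectiveˡ i r i′ r (Fin.toℕ-injective q)

  -- When two classes occur, each class `k` differs from at least one of them, and a member of that
  -- one bounds the part in class `k` through `two-classes`.
  one-parity : ∀ r F → Unique F → (∀ {g} → g ∈ F → G g) → Intersecting F →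
    (∀ {g} → g ∈ F → ∃[ i ] Class (index i r) g) → length F ≤ (3 ⊔ e) * ∣K₀∣
  one-parity r F u GF meet CF = [ several , single ]′ (toSum (em Several))
    where
    Several : Set
    Several = ∃[ g ] ∃[ h ] ∃[ i ] ∃[ j ]
      (g ∈ F × h ∈ F × i ≢ j × Class (index i r) g × Class (index j r) h)
    several : Several → length F ≤ (3 ⊔ e) * ∣K₀∣
    several (g , h , i , j , g∈ , h∈ , i≢j , Cg , Ch) = ℕ.≤-trans
      (fibre-bound (λ k → Class (index k r)) (λ k f → em (Class (index k r) f)) F u CF bound)
      (ℕ.*-monoˡ-≤ ∣K₀∣ (ℕ.m≤n⊔m 3 e))
      where
      bound-by : ∀ {k i g} → g ∈ F → i ≢ k → Class (index i r) g → ∀ E → Unique E →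
        (∀ {f} → f ∈ E → f ∈ F × Class (index k r) f) → length E ≤ ∣K₀∣
      bound-by {k} {i} {g} g∈ i≢k Cg E uE sub =
        two-classes {g = g} (i≢k ∘ index-injective {i} {k} {r}) (index<d i r) (index<d k r)
          (trans (parity-index i r) (sym (parity-index k r))) Cg E uE
          (λ f∈ → GF (proj₁ (sub f∈))) (λ f f′ f∈ f′∈ → meet f f′ (proj₁ (sub f∈)) (proj₁ (sub f′∈)))
          (λ f∈ → proj₂ (sub f∈)) (λ {f} f∈ → meet g f g∈ (proj₁ (sub f∈)))
      bound : ∀ k E → Unique E → (∀ {f} → f ∈ E → f ∈ F × Class (index k r) f) → length E ≤ ∣K₀∣
      bound k = [ (λ i≡k → bound-by h∈ (λ j≡k → i≢j (trans i≡k (sym j≡k))) Ch) ,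
                  (λ i≢k → bound-by g∈ i≢k Cg) ]′ (toSum (i Fin.≟ k))
    single : ¬ Several → length F ≤ (3 ⊔ e) * ∣K₀∣
    single none = ℕ.≤-trans (single-class F u GF meet CF none) (ℕ.*-monoˡ-≤ ∣K₀∣ (ℕ.m≤m⊔n 3 e))
      where
      single-class : ∀ F → Unique F → (∀ {g} → g ∈ F → G g) → Intersecting F →
        (∀ {g} → g ∈ F → ∃[ i ] Class (index i r) g) →
        ¬ (∃[ g ] ∃[ h ] ∃[ i ] ∃[ j ]
          (g ∈ F × h ∈ F × i ≢ j × Class (index i r) g × Class (index j r) h)) →
        length F ≤ 3 * ∣K₀∣
      single-class [] u GF meet CF none = z≤n
      single-class F@(g ∷ _) u GF meet CF none = let i , Cg = CF (here refl) in
        one-class (index i r) F u GF meet λ {h} h∈ → let j , Ch = CF h∈ in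
          subst (λ k → Class (index k r) h)
            (sym (decidable-stable (i Fin.≟ j) λ i≢j → none (g , h , i , j , here refl , h∈ , i≢j , Cg , Ch)))
            Ch

  upper : ∀ F → Unique F → All H F → Intersecting F → length F ≤ 2 * ((3 ⊔ e) * ∣K₀∣)
  upper F u HF meet = fibre-bound (λ r g → ∃[ i ] Class (index i r) g)
    (λ r g → em (∃[ i ] Class (index i r) g)) F u (λ g∈ → class-index (GF g∈))
    λ r E uE sub → one-parity r E uE (λ f∈ → GF (proj₁ (sub f∈)))
      (λ f f′ f∈ f′∈ → meet f f′ (proj₁ (sub f∈)) (proj₁ (sub f′∈))) (λ f∈ → proj₂ (sub f∈))
    where
    GF : ∀ {g} → g ∈ F → G g
    GF g∈ = H⊆G (All.lookup HF g∈)

  -- Families attaining the bound.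

  attained : ∀ {P m} → HasSize P m → (∀ {σ} → P σ → H σ) → (∀ {σ τ} → P σ → P τ → Meets σ τ) →
    ∃[ F ] (Unique F × All H F × Intersecting F × length F ≡ m)
  attained (L , u , L⇔ , ∣L∣) P⊆H meet = L , u , All.tabulate (λ {σ} σ∈ → P⊆H (to (L⇔ σ) σ∈)) ,
    (λ σ τ σ∈ τ∈ → meet {σ} {τ} (to (L⇔ σ) σ∈) (to (L⇔ τ) τ∈)) , ∣L∣

  -- The quotient of `σ` and `τ` lies in `K`, which contains no derangement.
  K-meets : ∀ {σ τ} → K σ → K τ → Meets σ τ
  K-meets {σ} {τ} Kσ Kτ =
    let κ = inverse (proj₁ Kσ) · τ
        x , κx = K-fixes κ (quotient∈K (proj₁ Kσ) (proj₁ Kτ) λ y → trans (proj₂ Kσ y) (sym (proj₂ Kτ y)))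
    in x , sym (trans (cong (_$ x) (sym (undo (proj₁ Kσ) τ))) (trans (·-$ σ κ x) (cong (σ $_) κx)))

  -- On block 0, which `b` keeps, `σ` is a translation and `b · τ` a reflection, and these always
  -- share a value.
  K-meets-bK : ∀ {σ τ} → K σ → K τ → Meets σ (b · τ)
  K-meets-bK {σ} {τ} Kσ Kτ =
    let c , q = K-even {σ} Kσ (res 0)
        c₁ , q₁ = K-even {τ} Kτ (res 0)
        c₂ , q₂ = b-odd 0
        l , r = even-odd-meet c (act 1F c₂ c₁)
    in at (res 0) l , trans (q l) (sym (trans (·-$ b τ _) (trans (cong (b $_) (q₁ l)) (trans (q₂ _)
      (cong₂ at (cong res (ℕ.*-zeroʳ t)) (trans (act-∘ 1F 0F c₂ c₁ l) (sym r)))))))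

  rep : Fin 2 → Map (p * 3)
  rep 0F = idP
  rep 1F = b

  rep-class : ∀ i → Class (toℕ i) (rep i)
  rep-class 0F = 0 , Affine-K {idP} K-id
  rep-class 1F = 0 , Affine-b

  G-rep : ∀ i → G (rep i)
  G-rep 0F = id∈
  G-rep 1F = Gb

  K∪bK : PSet (p * 3)
  K∪bK σ = ∃[ i ] ∃[ τ ] (K τ × σ ≡ rep i · τ)

  size-K∪bK : HasSize K∪bK (2 * (3 * ∣K₀∣))
  size-K∪bK = size-cosets (size-K 0 (size-Kfix 0)) rep (λ i → perm _ (G-rep i)) distinct
      (λ σ → mk⇔ (λ x → x) (λ x → x))
    where
    -- Since `d` is even and positive, 0 and 1 are distinct classes below it, which separates `K`
    -- from `bK`.
    2≤d : ∀ e → 0 < e * 2 → 2 ≤ e * 2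
    2≤d (suc e) _ = s≤s (s≤s z≤n)
    below : (i : Fin 2) → toℕ i < d
    below i = ℕ.≤-trans (Fin.toℕ<n i) (2≤d e 0<d)
    distinct : ∀ i j σ τ → K σ → K τ → rep i · σ ≡ rep j · τ → i ≡ j
    distinct i j σ τ Kσ Kτ q = Fin.toℕ-injective (class-unique {g = rep j · τ} (below i) (below j)
      (subst (Class (toℕ i)) q (class-coset {toℕ i} {rep i} {σ} (rep-class i) Kσ))
      (class-coset {toℕ j} {rep j} {τ} (rep-class j) Kτ))

  K∪bK⊆H : ∀ {σ} → K∪bK σ → H σ
  K∪bK⊆H (i , τ , Kτ , refl) = G⊆H (mul∈ _ τ (G-rep i) (proj₁ Kτ))

  rep-meets : ∀ i j {σ τ} → K σ → K τ → Meets (rep i · σ) (rep j · τ)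
  rep-meets 0F 0F {σ} {τ} Kσ Kτ = subst₂ Meets (sym (·-idˡ σ)) (sym (·-idˡ τ)) (K-meets {σ} {τ} Kσ Kτ)
  rep-meets 0F 1F {σ} {τ} Kσ Kτ = subst (λ g → Meets g (b · τ)) (sym (·-idˡ σ)) (K-meets-bK {σ} {τ} Kσ Kτ)
  rep-meets 1F 0F {σ} {τ} Kσ Kτ = let x , q = rep-meets 0F 1F {τ} {σ} Kτ Kσ in x , sym q
  rep-meets 1F 1F {σ} {τ} Kσ Kτ = let x , q = K-meets {σ} {τ} Kσ Kτ in
    x , trans (·-$ b σ x) (trans (cong (b $_) q) (sym (·-$ b τ x)))

  K∪bK-meets : ∀ {g h} → K∪bK g → K∪bK h → Meets g h
  K∪bK-meets (i , σ , Kσ , refl) (j , τ , Kτ , refl) = rep-meets i j {σ} {τ} Kσ Kτ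

  max-size : IsMaxIntersectingSize H (2 * ((3 ⊔ e) * ∣K₀∣))
  max-size = [ (λ e≤3 → attained (subst (HasSize K∪bK) (few e≤3) size-K∪bK) K∪bK⊆H K∪bK-meets) ,
               (λ 3≤e → attained (subst (HasSize Stab) (many 3≤e) size-Stab) proj₁
                 (λ (_ , fσ) (_ , fτ) → ω , trans fσ (sym fτ))) ]′ (ℕ.≤-total e 3) , upper
    where
    few : e ≤ 3 → 2 * (3 * ∣K₀∣) ≡ 2 * ((3 ⊔ e) * ∣K₀∣)
    few e≤3 = cong (λ m → 2 * (m * ∣K₀∣)) (sym (ℕ.m≥n⇒m⊔n≡m e≤3))
    many : 3 ≤ e → e * 2 * ∣K₀∣ ≡ 2 * ((3 ⊔ e) * ∣K₀∣)
    many 3≤e = trans (swap e ∣K₀∣) (cong (λ m → 2 * (m * ∣K₀∣)) (sym (ℕ.m≤n⇒m⊔n≡n 3≤e)))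
      where
      swap : ∀ e k → e * 2 * k ≡ 2 * (e * k)
      swap = solve-∀

  stab-size : IsStabSize H (pt fz fz) (d * ∣K₀∣)
  stab-size = subst (λ i → IsStabSize H (pt i 0F) (d * ∣K₀∣)) (sym fz-res) size-Stab

-- The ratio max{1, 6/d} = max(d, 6)/d, cross-multiplied.

ratio : ∀ e k → 2 * ((3 ⊔ e) * k) * (e * 2) ≡ e * 2 * k * ((e * 2) ⊔ 6)
ratio e k = begin
  2 * ((3 ⊔ e) * k) * (e * 2)    ≡⟨ swap (3 ⊔ e) e k ⟩
  e * 2 * k * ((3 ⊔ e) * 2)      ≡⟨ cong (λ m → e * 2 * k * (m * 2)) (ℕ.⊔-comm 3 e) ⟩
  e * 2 * k * ((e ⊔ 3) * 2)      ≡⟨ cong (e * 2 * k *_) (ℕ.*-distribʳ-⊔ 2 e 3) ⟩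
  e * 2 * k * ((e * 2) ⊔ 6)      ∎
  where
  open ≡-Reasoning
  swap : ∀ m e k → 2 * (m * k) * (e * 2) ≡ e * 2 * k * (m * 2)
  swap = solve-∀

-- The even values 2, 4, 6 of `d` give the ratios 3, 3/2 and 1 in turn.
small-ratio : ∀ e k → 0 < e * 2 → e * 2 ≤ 6 → let m = 2 * ((3 ⊔ e) * k) ; s = e * 2 * k in
  m ≡ s ⊎ 2 * m ≡ 3 * s ⊎ m ≡ 3 * s
small-ratio 1 k _ _ = inj₂ (inj₂ (lemma k))
  where
  lemma : ∀ k → 2 * (3 * k) ≡ 3 * (2 * k)
  lemma = solve-∀
small-ratio 2 k _ _ = inj₂ (inj₁ (lemma k))
  where
  lemma : ∀ k → 2 * (2 * (3 * k)) ≡ 3 * (4 * k)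
  lemma = solve-∀
small-ratio 3 k _ _ = inj₁ (lemma k)
  where
  lemma : ∀ k → 2 * (3 * k) ≡ 6 * k
  lemma = solve-∀
small-ratio (suc (suc (suc (suc e)))) k _ (s≤s (s≤s (s≤s (s≤s (s≤s (s≤s ()))))))

theorem7p6 :
  (p : ℕ) .{{_ : NonZero p}} → Prime p → 5 ≤ p →
  (G : PSet (p * 3)) → IsSubgroup G → Transitive G →
  -- B is G-invariant and is the only non-trivial G-invariant partition
  IsInvariantPartition G (SameBlock {p}) →
  (∀ (R : Fin (p * 3) → Fin (p * 3) → Set) → IsInvariantPartition G R → NonTrivialRel R →
    ∀ x y → R x y ⇔ SameBlock {p} x y) →
  -- hypotheses on K
  ¬ Trivial (Ker {p} G) →
  (∀ σ → Ker {p} G σ → ∃[ x ] (σ $ x ≡ x)) →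
  (∀ (N : PSet (p * 3)) → N ⊆ Ker {p} G → IsMinimalNormal G N → IsElemAbelian3 N) →
  (∀ σ → Ker {p} G σ → σ · σ ≡ idP → σ ≡ idP) →
  -- Ḡ is non-cyclic and contained in AGL(1,p) (hence solvable)
  ¬ Cyclic (Bar {p} G) → (∀ σ → Bar {p} G σ → InAGL1 σ) →
  (d t : ℕ) (a b : Map (p * 3)) → G a → G b →
  (∀ i j → a $ pt i j ≡ pt (sucMod i) j) →
  HasOrder (ind {p} b) d → 2 ∣ d → d ∣ p ∸ 1 →
  ind {p} b $ fz ≡ fz →
  ind {p} b · alpha ≡ pow alpha t · ind {p} b →
  Coprime t p →
  (∀ σ → Bar {p} G σ ⇔ Gen (λ τ → τ ≡ alpha ⊎ τ ≡ ind {p} b) σ) →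
  -- the restriction of b to B_1 is a transposition
  (∃[ j ] ∃[ k ] (j ≢ k × b $ pt fz j ≡ pt fz k × b $ pt fz k ≡ pt fz j ×
    (∀ l → l ≢ j → l ≢ k → b $ pt fz l ≡ pt fz l))) →
  -- ρ(G(a,b)) = m / s = max{1, 6/d}
  ∃[ m ] ∃[ s ]
    (IsMaxIntersectingSize (Gen (λ σ → Ker {p} G σ ⊎ σ ≡ a ⊎ σ ≡ b)) m ×
     IsStabSize (Gen (λ σ → Ker {p} G σ ⊎ σ ≡ a ⊎ σ ≡ b)) (pt fz fz) s ×
     m * d ≡ s * (d ⊔ 6) ×
     (d ≤ 6 → m ≡ s ⊎ 2 * m ≡ 3 * s ⊎ m ≡ 3 * s))
theorem7p6 p pr 5≤p G subgroup transitive partition only K-nontrivial K-fixes _ K-no-involution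
  _ _ .(e * 2) t a b Ga Gb a-acts b-order (∣.divides-refl e) _ b-fixes b-rel _ bar⇔
  (j , k , j≢k , bj , bk , _) =
    _ , _ , max-size , stab-size , ratio e ∣K₀∣ , small-ratio e ∣K₀∣ 0<d
  where
  open Setting p e t pr 5≤p G subgroup transitive partition only K-nontrivial K-fixes
    K-no-involution a b Ga Gb a-acts b-order b-fixes b-rel (λ σ → to (bar⇔ σ)) (j , k , j≢k , bj , bk)
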